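{- The problem Uniform Cluster Vertex Deletion (UCVD), parameterized by the solution size $k$, can be solved in $2^{k}\cdot n^{\mathcal{O}(1)}$ time, where $n$ is the number of vertices of the input graph.
   Context: All graphs are finite, simple and undirected. A uniform cluster graph is a graph that is a disjoint union of cliques, all of the same size. UCVD: Input: a graph $G=(V,E)$ and a positive integer $k$. Question: is there a subset $S\subseteq V$ with $|S|\le k$ such that $G-S$ is a uniform cluster graph? -}

module Defs where

open import Data.Bool using (Bool; true; false; _∧_; not)
open import Data.Fin using (Fin; _≟_)
open import Data.Fin.Subset using (Subset; _∈_; ∁; ∣_∣)
open import Data.List using (List; []; _∷_; tabulate)
open import Data.Nat using (ℕ; zero; suc; _+_; _≤_)
open import Data.Product using (∃; ∃₂; ∃-syntax; _×_; _,_; proj₁)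
open import Data.Vec as Vec using (Vec; []; _∷_)
open import Function using (_↔_; Inverse)
open import Relation.Binary.PropositionalEquality using (_≡_; refl; sym; cong; cong₂)
open import Relation.Nullary using (Reflects; does; yes; no; contradiction)

record Graph (V : Set) : Set where
  field
    adj      : V → V → Bool
    adj-sym  : ∀ u v → adj u v ≡ adj v u
    adj-irr  : ∀ v → adj v v ≡ false

open Graph public

record _≅_ {V W : Set} (G : Graph V) (H : Graph W) : Set where
  field
    bijection : V ↔ W
    adj-pres  : ∀ u v →
      adj G u v ≡ adj H (Inverse.to bijection u) (Inverse.to bijection v)

-- Membership in ∁ S is proof-irrelevant, so the vertices of G - S are exactly
-- the vertices of G outside S, without repetition.
_-_ : ∀ {n} → Graph (Fin n) → (S : Subset n) → Graph (∃ λ v → v ∈ ∁ S)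
adj     (G - S) u v = adj G (proj₁ u) (proj₁ v)
adj-sym (G - S) u v = adj-sym G (proj₁ u) (proj₁ v)
adj-irr (G - S) v   = adj-irr G (proj₁ v)

private
  ≟-sym : ∀ {n} (i j : Fin n) → does (i ≟ j) ≡ does (j ≟ i)
  ≟-sym i j with i ≟ j | j ≟ i
  ... | yes _  | yes _  = refl
  ... | no _   | no _   = refl
  ... | yes eq | no ne  = contradiction (sym eq) ne
  ... | no ne  | yes eq = contradiction (sym eq) ne

  ≟-self : ∀ {n} (i : Fin n) → does (i ≟ i) ≡ true
  ≟-self i with i ≟ i
  ... | yes _ = refl
  ... | no ne = contradiction refl ne

-- The disjoint union of m cliques of size d: vertex (i , x) is the x-th vertex
-- of the i-th clique.
cliques : ∀ m d → Graph (Fin m × Fin d)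
adj     (cliques m d) (i , x) (j , y) = does (i ≟ j) ∧ not (does (x ≟ y))
adj-sym (cliques m d) (i , x) (j , y) = cong₂ _∧_ (≟-sym i j) (cong not (≟-sym x y))
adj-irr (cliques m d) (i , x) rewrite ≟-self i | ≟-self x = refl

UniformCluster : {V : Set} → Graph V → Set
UniformCluster G = ∃₂ λ m d → G ≅ cliques m d

UCVD : ∀ {n} → Graph (Fin n) → ℕ → Set
UCVD {n} G k = ∃[ S ] ∣ S ∣ ≤ k × UniformCluster (G - S)

-- Model of computation: a first-order, call-by-value Lisp whose only data are
-- binary trees.  A program is a finite syntax tree that does not depend on its
-- input: finitely many mutually recursive functions and a main expression.
-- Every evaluation step touches only constantly many pointers (trees are
-- passed by reference, never copied or compared), so a computation of t steps
-- takes O(t) time on a RAM with words of O(log t) bits.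

data Val : Set where
  nil  : Val
  cons : Val → Val → Val

-- Expressions over functions with arities ar, with n free variables
-- (de Bruijn indices).  In match e a b, the branch b binds the head of the
-- pair as variable 0 and its tail as variable 1.
data Exp {p} (ar : Fin p → ℕ) (n : ℕ) : Set where
  var   : Fin n → Exp ar n
  nil   : Exp ar n
  cons  : Exp ar n → Exp ar n → Exp ar n
  match : Exp ar n → Exp ar n → Exp ar (2 + n) → Exp ar n
  bind  : Exp ar n → Exp ar (suc n) → Exp ar n
  call  : (f : Fin p) → Vec (Exp ar n) (ar f) → Exp ar n

record Program (inputs : ℕ) : Set where
  field
    size  : ℕ
    arity : Fin size → ℕ
    body  : ∀ f → Exp arity (arity f)
    main  : Exp arity inputs

module Semantics {p} {ar : Fin p → ℕ} (body : ∀ f → Exp ar (ar f)) where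

  infix 4 _⊢_⇓_∣_ _⊢*_⇓_∣_

  -- ρ ⊢ e ⇓ v ∣ t : in environment ρ, e evaluates to v in t steps.
  data _⊢_⇓_∣_ {n} (ρ : Vec Val n) : Exp ar n → Val → ℕ → Set
  data _⊢*_⇓_∣_ {n} (ρ : Vec Val n) : ∀ {m} → Vec (Exp ar n) m → Vec Val m → ℕ → Set

  data _⊢_⇓_∣_ {n} ρ where
    var : ∀ x → ρ ⊢ var x ⇓ Vec.lookup ρ x ∣ 1

    nil : ρ ⊢ nil ⇓ nil ∣ 1

    cons : ∀ {e₁ e₂ v₁ v₂ t₁ t₂} →
      ρ ⊢ e₁ ⇓ v₁ ∣ t₁ →
      ρ ⊢ e₂ ⇓ v₂ ∣ t₂ →
      ρ ⊢ cons e₁ e₂ ⇓ cons v₁ v₂ ∣ suc (t₁ + t₂)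

    match-nil : ∀ {e a b v t₁ t₂} →
      ρ ⊢ e ⇓ nil ∣ t₁ →
      ρ ⊢ a ⇓ v ∣ t₂ →
      ρ ⊢ match e a b ⇓ v ∣ suc (t₁ + t₂)

    match-cons : ∀ {e a b v₁ v₂ v t₁ t₂} →
      ρ ⊢ e ⇓ cons v₁ v₂ ∣ t₁ →
      v₁ ∷ v₂ ∷ ρ ⊢ b ⇓ v ∣ t₂ →
      ρ ⊢ match e a b ⇓ v ∣ suc (t₁ + t₂)

    bind : ∀ {e b u v t₁ t₂} →
      ρ ⊢ e ⇓ u ∣ t₁ →
      u ∷ ρ ⊢ b ⇓ v ∣ t₂ →
      ρ ⊢ bind e b ⇓ v ∣ suc (t₁ + t₂)

    call : ∀ {f es vs v t₁ t₂} →
      ρ ⊢* es ⇓ vs ∣ t₁ →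
      vs ⊢ body f ⇓ v ∣ t₂ →
      ρ ⊢ call f es ⇓ v ∣ suc (t₁ + t₂)

  data _⊢*_⇓_∣_ {n} ρ where
    []  : ρ ⊢* [] ⇓ [] ∣ 0

    _∷_ : ∀ {m e v t₁ t₂} {es : Vec (Exp ar n) m} {vs : Vec Val m} →
      ρ ⊢ e ⇓ v ∣ t₁ →
      ρ ⊢* es ⇓ vs ∣ t₂ →
      ρ ⊢* e ∷ es ⇓ v ∷ vs ∣ t₁ + t₂

_on_returns_inTime_ : ∀ {i} → Program i → Vec Val i → Val → ℕ → Set
P on inputs returns v inTime t = inputs ⊢ main ⇓ v ∣ t
  where open Program P
        open Semantics body

encodeBool : Bool → Val
encodeBool false = nil
encodeBool true  = cons nil nil

encodeℕ : ℕ → Val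
encodeℕ zero    = nil
encodeℕ (suc k) = cons nil (encodeℕ k)

encodeList : List Val → Val
encodeList []       = nil
encodeList (v ∷ vs) = cons v (encodeList vs)

-- The adjacency matrix, row by row.
encodeGraph : ∀ {n} → Graph (Fin n) → Val
encodeGraph G =
  encodeList (tabulate λ u → encodeList (tabulate λ v → encodeBool (adj G u v)))

-- On the given input, P halts within T steps with the correct answer to the
-- yes/no question A.
Decides : ∀ {i} → Program i → Vec Val i → Set → ℕ → Set
Decides P inputs A T =
  ∃[ b ] ∃[ t ] (P on inputs returns encodeBool b inTime t) × Reflects A b × t ≤ T

{-# OPTIONS --safe #-}
module Submission where

-- Guess the cluster size D + 1 and branch on a vertex v.  If N[v] is an isolated clique of
-- that size, take it as a cluster.  Otherwise delete v, or keep it; in the second case N[v] has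
-- to become an isolated clique with D + 1 vertices.  A conflict (u , w), where u is a neighbour
-- of v and w is adjacent to exactly one of u and v, forces the deletion of u or w.
--
-- Keeping v costs only half of 2 ^ k, which leaves the other half for deleting v.  Let
-- e = |N(v)| - D be the surplus.  If e = 0, then u cannot be deleted and the split has only one
-- live branch.  If e > 0 and the deletion of a single neighbour u (or of none) isolates a clique
-- N[v], then the e deleted neighbours may be taken to be u and any others: there is no split,
-- and at least one deletion.  In all other cases both branches of the split keep a positive
-- surplus or a conflict, so each of them costs again only half of 2 ^ (k - 1).

open import Defs
open import Data.Bool using (Bool; true; false; _∧_; _∨_; _xor_; not; T)
open import Data.Bool.Properties using (T-≡; not-injective; ∧-zeroʳ; ∨-zeroʳ)
open import Data.Empty using (⊥; ⊥-elim)
open import Data.Fin using (Fin; zero; suc; toℕ; _≟_; punchIn; punchOut)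
open import Data.Fin.Patterns
open import Data.Fin.Properties
  using (any?; toℕ<n; ¬Fin0; punchIn-injective; punchIn-punchOut; punchInᵢ≢i)
open import Data.Fin.Subset using (Subset; ∁; ∣_∣)
import Data.Fin.Subset as Subset
open import Data.List using (List; []; _∷_; length; filterᵇ; tabulate; allFin; lookup)
import Data.List as List
open import Data.List.Properties using (length-filter; filter-notAll; length-tabulate)
open import Data.List.Membership.Propositional using (_∈_)
open import Data.List.Membership.Propositional.Properties
  using (∈-filter⁺; ∈-filter⁻; ∈-lookup; ∈-allFin; ∈-tabulate⁺; ∈-tabulate⁻)
open import Data.List.Relation.Unary.All as All using ([]; _∷_)
open import Data.List.Relation.Unary.AllPairs using ([]; _∷_)
open import Data.List.Relation.Unary.Any as Any using (here; there)
open import Data.List.Relation.Unary.Any.Properties using (lookup-index)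
open import Data.List.Relation.Unary.Unique.Propositional using (Unique)
open import Data.List.Relation.Unary.Unique.Propositional.Properties
  using (Unique[x∷xs]⇒x∉xs; tabulate⁺; allFin⁺; filter⁺)
open import Data.Nat
  using (ℕ; zero; suc; pred; _+_; _*_; _∸_; _^_; _≤_; _<_; z≤n; s≤s; NonZero)
open import Data.Nat.Properties hiding (_≟_)
open import Data.Nat.Tactic.RingSolver using (solve-∀)
open import Data.Product using (∃; ∃₂; ∃-syntax; _×_; _,_; proj₁; proj₂)
open import Data.Sum using (_⊎_; inj₁; inj₂)
open import Data.Vec as Vec using (Vec; []; _∷_) renaming (lookup to _‼_)
import Data.Vec.Properties as Vecₚ
import Data.Vec.Properties.WithK as Vecₚ
open import Function using (_∘_; id; Equivalence; Inverse; mk↔ₛ′)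
open import Relation.Binary.PropositionalEquality
open import Relation.Nullary using (¬_; Dec; does; yes; no; contradiction; Reflects; ofʸ; ofⁿ)
open import Relation.Nullary.Decidable using (dec-true; dec-false)

-- Branching on which vertex of an induced path v, u, w is deleted gives 3 ^ k. The base drops to 2
-- because deleting v uses budget at once, while keeping v pins the number of deleted neighbours to
-- the surplus e. Whichever e neighbours a solution deletes, what remains is the set of
-- non-neighbours of v with k - e deletions, so only their number matters. An isolated cluster must
-- be recognized before branching: keeping its vertex spends no budget, so that branch alone would
-- cost the full 2 ^ k, with the deletion of v on top. Inside a split with e = 0 the same happens
-- when deleting w isolates N[v]; there it is affordable because the sibling that deletes u dies at
-- once. The time bounds carry a factor linear in the number of remaining vertices; its decrease
-- absorbs the polynomial work of the branching, so the base stays exactly 2. Soundness goes through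
-- `Cert`, an inductive trace of moves on the current vertex list; completeness goes through `Sol`,
-- the restriction of one fixed deletion set to that list.

true≢false : true ≢ false
true≢false ()

-- Counting and filtering in lists

module _ {A : Set} where

  ∈-filterᵇ⁺ : ∀ (p : A → Bool) {x xs} → x ∈ xs → p x ≡ true → x ∈ filterᵇ p xs
  ∈-filterᵇ⁺ p x∈ px = ∈-filter⁺ _ x∈ (Equivalence.from T-≡ px)

  ∈-filterᵇ⁻ : ∀ (p : A → Bool) {x xs} → x ∈ filterᵇ p xs → x ∈ xs × p x ≡ true
  ∈-filterᵇ⁻ p {xs = xs} x∈ with ∈-filter⁻ _ {xs = xs} x∈
  ... | x∈xs , px = x∈xs , Equivalence.to T-≡ px

  count : (A → Bool) → List A → ℕ
  count p xs = length (filterᵇ p xs)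

  count≤length : ∀ (p : A → Bool) xs → count p xs ≤ length xs
  count≤length p = length-filter _

  count-false : ∀ {p : A → Bool} xs → (∀ {x} → x ∈ xs → p x ≡ false) → count p xs ≡ 0
  count-false []       eq = refl
  count-false {p} (x ∷ xs) eq with p x | eq (here refl)
  ... | false | refl = count-false xs (eq ∘ there)

  count-split : ∀ (p q : A → Bool) xs →
    count p xs ≡ count p (filterᵇ q xs) + count p (filterᵇ (not ∘ q) xs)
  count-split p q [] = refl
  count-split p q (x ∷ xs) with q x
  count-split p q (x ∷ xs) | true with p x
  ... | true  = cong suc (count-split p q xs)
  ... | false = count-split p q xs
  count-split p q (x ∷ xs) | false with p x
  ... | true  = trans (cong suc (count-split p q xs)) (sym (+-suc _ _))
  ... | false = count-split p q xs

  count-filterᵇ : ∀ (p q : A → Bool) xs → count p (filterᵇ q xs) ≡ count (λ x → q x ∧ p x) xs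
  count-filterᵇ p q [] = refl
  count-filterᵇ p q (x ∷ xs) with q x
  ... | false = count-filterᵇ p q xs
  ... | true with p x
  ... | true  = cong suc (count-filterᵇ p q xs)
  ... | false = count-filterᵇ p q xs

  length-split : ∀ (q : A → Bool) xs →
    length xs ≡ count q xs + count (not ∘ q) xs
  length-split q [] = refl
  length-split q (x ∷ xs) with q x
  ... | true  = cong suc (length-split q xs)
  ... | false = trans (cong suc (length-split q xs)) (sym (+-suc _ _))

  filterᵇ-unique : ∀ (p : A → Bool) {xs} → Unique xs → Unique (filterᵇ p xs)
  filterᵇ-unique p = filter⁺ _

  lookup-injective : ∀ {xs : List A} → Unique xs → ∀ {i j} → lookup xs i ≡ lookup xs j → i ≡ j
  lookup-injective {xs = _ ∷ _} u {zero} {zero} eq = refl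
  lookup-injective {xs = _ ∷ xs} u {zero} {suc j} eq =
    contradiction (subst (_∈ xs) (sym eq) (∈-lookup j)) (Unique[x∷xs]⇒x∉xs u)
  lookup-injective {xs = _ ∷ xs} u {suc i} {zero} eq =
    contradiction (subst (_∈ xs) eq (∈-lookup i)) (Unique[x∷xs]⇒x∉xs u)
  lookup-injective {xs = _ ∷ _} (_ ∷ u) {suc i} {suc j} eq = cong suc (lookup-injective u eq)

module _ {n : ℕ} where

  rem : Fin n → List (Fin n) → List (Fin n)
  rem u = filterᵇ (λ x → not (does (u ≟ x)))

  rem-unique : ∀ u {X} → Unique X → Unique (rem u X)
  rem-unique u = filterᵇ-unique (λ x → not (does (u ≟ x)))

  ∈-rem⁻ : ∀ u {x} X → x ∈ rem u X → x ∈ X × u ≢ x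
  ∈-rem⁻ u {x} X x∈ with ∈-filterᵇ⁻ (λ x → not (does (u ≟ x))) {xs = X} x∈
  ... | x∈X , px with u ≟ x
  ... | no u≢x = x∈X , u≢x

  ∈-rem⁺ : ∀ u {x X} → x ∈ X → u ≢ x → x ∈ rem u X
  ∈-rem⁺ u {x} x∈ u≢x = ∈-filterᵇ⁺ (λ x → not (does (u ≟ x))) x∈ (cong not (dec-false (u ≟ x) u≢x))

  rem-fresh : ∀ {u : Fin n} X → ¬ (u ∈ X) → rem u X ≡ X
  rem-fresh [] u∉ = refl
  rem-fresh {u} (x ∷ X) u∉ with u ≟ x
  ... | yes refl = contradiction (here refl) u∉
  ... | no  _    = cong (x ∷_) (rem-fresh X (u∉ ∘ there))

  filterᵇ-rem : ∀ (p : Fin n → Bool) {u} X → p u ≡ false → filterᵇ p (rem u X) ≡ filterᵇ p X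
  filterᵇ-rem p [] pu = refl
  filterᵇ-rem p {u} (x ∷ X) pu with u ≟ x
  filterᵇ-rem p {u} (.u ∷ X) pu | yes refl with p u | pu
  ... | false | refl = filterᵇ-rem p X pu
  filterᵇ-rem p {u} (x ∷ X) pu | no _ with p x
  ... | true  = cong (x ∷_) (filterᵇ-rem p X pu)
  ... | false = filterᵇ-rem p X pu

  count-rem : ∀ (p : Fin n → Bool) {u} {X} → Unique X → u ∈ X → p u ≡ true →
    count p X ≡ suc (count p (rem u X))
  count-rem p {u} {x ∷ X} uq u∈ pu with u ≟ x
  count-rem p {u} {.u ∷ X} uq u∈ pu | yes refl with p u | pu
  ... | true | refl rewrite rem-fresh X (Unique[x∷xs]⇒x∉xs uq) = refl
  count-rem p {u} {x ∷ X} uq (here refl) pu | no u≢x = contradiction refl u≢x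
  count-rem p {u} {x ∷ X} (_ ∷ uq) (there u∈) pu | no _ with p x
  ... | true  = cong suc (count-rem p uq u∈ pu)
  ... | false = count-rem p uq u∈ pu

  length-rem : ∀ {u : Fin n} {X} → u ∈ X → length (rem u X) < length X
  length-rem {u} {X} u∈ = filter-notAll _ X (Any.map (λ { refl → remove-self }) u∈)
    where
    remove-self : ¬ T (not (does (u ≟ u)))
    remove-self rewrite dec-true (u ≟ u) refl = λ ()

  length-mono : ∀ {X Y : List (Fin n)} → Unique X → (∀ {x} → x ∈ X → x ∈ Y) → length X ≤ length Y
  length-mono {[]} _ _ = z≤n
  length-mono {x ∷ X} {Y} uq@(_ ∷ uqX) X⊆Y = ≤-trans
    (s≤s (length-mono uqX λ y∈ → ∈-rem⁺ x (X⊆Y (there y∈)) λ { refl → Unique[x∷xs]⇒x∉xs uq y∈ }))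
    (length-rem {X = Y} (X⊆Y (here refl)))

-- Certificates and solutions

module Combinatorics {n : ℕ} (G : Graph (Fin n)) where

  V : Set
  V = Fin n

  a : V → V → Bool
  a = adj G

  -- A conflict (u , w) of v is an obstruction to N[v] being an isolated clique:
  -- if v and its neighbour u are kept, then v, u, w induce a path on three vertices.
  Confl : V → V → V → Bool
  Confl v u w = a v u ∧ (not (does (u ≟ w)) ∧ (a u w xor a v w))

  Free : V → List V → Set
  Free v X = ∀ {u w} → u ∈ X → w ∈ X → Confl v u w ≡ false

  nbrs non : V → List V → List V
  nbrs v = filterᵇ (a v)
  non v = filterᵇ (not ∘ a v)

  no-conflict : ∀ {v u w} → Confl v u w ≡ false → a v u ≡ true → u ≢ w → a u w ≡ a v w
  no-conflict {v} {u} {w} eq vu u≢w with a v u | vu | u ≟ w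
  ... | true | refl | yes p = contradiction p u≢w
  ... | true | refl | no _ with a u w | a v w
  ... | true  | true  = refl
  ... | false | false = refl

  ∈-non⁻ : ∀ {v w} X → w ∈ non v X → w ∈ X × a v w ≡ false
  ∈-non⁻ {v} X w∈ = let w∈X , vw = ∈-filterᵇ⁻ (not ∘ a v) {xs = X} w∈ in w∈X , not-injective vw

  Free-rem : ∀ {v X} z → Free v X → Free v (rem z X)
  Free-rem {X = X} z free u∈ w∈ = free (proj₁ (∈-rem⁻ z X u∈)) (proj₁ (∈-rem⁻ z X w∈))

  separated : ∀ {v u w} → a v u ≡ true → a v w ≡ false → u ≢ w
  separated vu vw refl with () ← trans (sym vu) vw

  -- D + 1 is the size of the clusters, k the number of deletions left.
  data Cert (D : ℕ) : List V → ℕ → Set where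
    done : ∀ {k} → Cert D [] k
    skip : ∀ {v X k} → Cert D X k → Cert D (v ∷ X) (suc k)
    del  : ∀ {v X k} u → u ∈ X → Cert D (v ∷ rem u X) k → Cert D (v ∷ X) (suc k)
    clq  : ∀ {v X k} → Free v X → count (a v) X ≡ D → Cert D (non v X) k → Cert D (v ∷ X) k

  -- Deleting neighbours of `v` does not change what is left once the cluster of `v` is taken, so it
  -- matters only how many of them are deleted.
  non-rem : ∀ {v u} X → a v u ≡ true → non v (rem u X) ≡ non v X
  non-rem {v} X vu = filterᵇ-rem (not ∘ a v) X (cong not vu)

  -- The surplus e is spent on neighbours of v, so that v stays.
  cert-leaf : ∀ {D v X k} e → Unique X → Free v X → count (a v) X ≡ e + D →
    Cert D (non v X) k → Cert D (v ∷ X) (e + k)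
  cert-leaf zero uq free eq c = clq free eq c
  cert-leaf {D} {v} {X} (suc e) uq free eq c with filterᵇ (a v) X in nb
  ... | z ∷ Z with ∈-filterᵇ⁻ (a v) {xs = X} (subst (z ∈_) (sym nb) (here refl))
  ... | z∈ , vz = del z z∈ (cert-leaf e (rem-unique z uq) (Free-rem {v} {X} z free)
    (cong pred (trans (sym (count-rem (a v) uq z∈ vz)) (trans (cong length nb) eq)))
    (subst (λ Y → Cert D Y _) (sym (non-rem X vz)) c))

  -- Deleting `u` removes every conflict of `v`, and further deletions create none, so the other `e`
  -- deletions may hit arbitrary neighbours.
  cert-fix : ∀ {D v X k u} e → Unique X → u ∈ X → a v u ≡ true → Free v (rem u X) →
    count (a v) X ≡ suc e + D → Cert D (non v X) k → Cert D (v ∷ X) (suc e + k)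
  cert-fix {D} {v} {X} {u = u} e uq u∈ vu free eq c = del u u∈ (cert-leaf e (rem-unique u uq) free
    (cong pred (trans (sym (count-rem (a v) uq u∈ vu)) eq))
    (subst (λ Y → Cert D Y _) (sym (non-rem X vu)) c))

  -- κ v ≡ true means that v is deleted.
  Clusters : (V → Bool) → Set
  Clusters κ = ∀ {v u w} → v ≢ w → κ v ≡ false → κ u ≡ false → κ w ≡ false → Confl v u w ≡ false

  -- `κ` is fixed for the whole graph while `L` shrinks, so `cluster` counts kept neighbours inside
  -- `L` only. The size condition is stated as a degree: together with `Clusters`, exactly `D` kept
  -- neighbours mean a clique on D + 1 kept vertices.
  record Sol (D : ℕ) (κ : V → Bool) (L : List V) (k : ℕ) : Set where
    field
      budget  : count κ L ≤ k
      cluster : ∀ {v} → v ∈ L → κ v ≡ false → count (λ w → a v w ∧ not (κ w)) L ≡ D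
  open Sol

  kept : (V → Bool) → V → V → Bool
  kept κ v w = a v w ∧ not (κ w)

  kept-deleted : ∀ κ v {w} → κ w ≡ true → kept κ v w ≡ false
  kept-deleted κ v {w} kw rewrite kw = ∧-zeroʳ (a v w)

  count-skip : ∀ {p : V → Bool} {v} X → p v ≡ false → count p (v ∷ X) ≡ count p X
  count-skip {p} {v} X pv with p v | pv
  ... | false | refl = refl

  count-take : ∀ {p : V → Bool} {v} X → p v ≡ true → count p (v ∷ X) ≡ suc (count p X)
  count-take {p} {v} X pv with p v | pv
  ... | true | refl = refl

  sol-skip : ∀ {D κ v X k} → κ v ≡ true → Sol D κ (v ∷ X) k →
    ∃[ k′ ] k ≡ suc k′ × Sol D κ X k′
  sol-skip {κ = κ} {v} {X} kv s with ≤-trans (≤-reflexive (sym (count-take {κ} X kv))) (budget s)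
  ... | s≤s le = _ , refl , record
    { budget  = le
    ; cluster = λ {x} x∈ kx → trans (sym (count-skip {kept κ x} X (kept-deleted κ x kv)))
        (cluster s (there x∈) kx) }

  sol-del : ∀ {D κ v X k u} → Unique (v ∷ X) → κ v ≡ false → u ∈ X → κ u ≡ true →
    Sol D κ (v ∷ X) k → ∃[ k′ ] k ≡ suc k′ × Sol D κ (v ∷ rem u X) k′
  sol-del {κ = κ} {v} {X} {u = u} (v∉X ∷ uq) kv u∈ ku s
    with ≤-trans (≤-reflexive (sym (trans (count-skip {κ} X kv) (count-rem κ uq u∈ ku)))) (budget s)
  ... | s≤s le = _ , refl , record
    { budget  = ≤-trans (≤-reflexive (count-skip {κ} (rem u X) kv)) le
    ; cluster = λ {x} x∈ kx → trans (same x) (cluster s (sub x∈) kx) }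
    where
    sub : ∀ {x} → x ∈ v ∷ rem u X → x ∈ v ∷ X
    sub (here eq)  = here eq
    sub (there x∈) = there (proj₁ (∈-rem⁻ u X x∈))
    same : ∀ x → count (kept κ x) (v ∷ rem u X) ≡ count (kept κ x) (v ∷ X)
    same x with kept κ x v
    ... | true  = cong suc (cong length (filterᵇ-rem (kept κ x) X (kept-deleted κ x ku)))
    ... | false = cong length (filterᵇ-rem (kept κ x) X (kept-deleted κ x ku))

  -- Nothing counted is lost: `v` and its kept neighbours are not adjacent to `w`, and deleted
  -- vertices were not counted.
  cluster-non : ∀ {D κ v w X} → a w v ≡ false →
    (∀ {x} → x ∈ X → a v x ≡ true → κ x ≡ false → a w x ≡ false) →
    count (kept κ w) (v ∷ X) ≡ D → count (kept κ w) (non v X) ≡ D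
  cluster-non {D} {κ} {v} {w} {X} wv sep eq = trans (sym lemma) eq
    where
    lemma : count (kept κ w) (v ∷ X) ≡ count (kept κ w) (non v X)
    lemma = trans (count-skip {kept κ w} X (cong (_∧ not (κ v)) wv))
      (trans (count-split (kept κ w) (a v) X)
      (cong (_+ count (kept κ w) (non v X)) (count-false (nbrs v X) λ {x} x∈ →
        let x∈X , vx = ∈-filterᵇ⁻ (a v) {xs = X} x∈ in out x x∈X vx)))
      where
      out : ∀ x → x ∈ X → a v x ≡ true → kept κ w x ≡ false
      out x x∈ vx with κ x in kx
      ... | true  = ∧-zeroʳ (a w x)
      ... | false = cong (_∧ true) (sep x∈ vx kx)

  -- `Clusters` cuts the kept neighbours of `v` off from the kept non-neighbours, so taking out all
  -- of N[v] leaves a solution. Here `e` is the number of deleted neighbours; since exactly `D` are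
  -- kept, it is determined by the degree of `v` and is the same for all solutions that keep `v`.
  sol-leaf : ∀ {D κ v X k} → Unique (v ∷ X) → Clusters κ → κ v ≡ false → Sol D κ (v ∷ X) k →
    ∃₂ λ e k′ → count (a v) X ≡ e + D × k ≡ e + k′ × Sol D κ (non v X) k′
  sol-leaf {D} {κ} {v} {X} {k} (v∉X ∷ _) cl kv s = e , k ∸ e , N≡ , sym (m+[n∸m]≡n e≤k) , record
    { budget  = ≤-trans (≤-reflexive (sym (m+n∸m≡n e _))) (∸-monoˡ-≤ e deleted)
    ; cluster = λ {w} w∈ kw → let w∈X , vw = ∈-non⁻ X w∈ in
        cluster-non {κ = κ} (trans (adj-sym G w v) vw)
          (λ {x} x∈ vx kx → trans (adj-sym G w x)
            (trans (no-conflict (cl (All.lookup v∉X w∈X) kv kx kw) vx (separated vx vw)) vw))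
          (cluster s (there w∈X) kw) }
    where
    e = count κ (nbrs v X)
    deleted : e + count κ (non v X) ≤ k
    deleted = ≤-trans (≤-reflexive (sym (trans (count-skip {κ} X kv) (count-split κ (a v) X)))) (budget s)
    e≤k : e ≤ k
    e≤k = ≤-trans (m≤m+n e _) deleted
    N≡ : count (a v) X ≡ e + D
    N≡ = trans (length-split κ (nbrs v X)) (cong (e +_)
      (trans (count-filterᵇ (not ∘ κ) (a v) X)
      (trans (sym (count-skip {kept κ v} X (cong (_∧ not (κ v)) (adj-irr G v))))
             (cluster s (here refl) kv))))

  -- N[v] is a component of the current graph, so any solution restricts to the other vertices,
  -- whether it keeps `v` or deletes it. This lets the search take an isolated cluster without
  -- branching.
  sol-isolated : ∀ {D κ v X k} → Free v X → Sol D κ (v ∷ X) k → Sol D κ (non v X) k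
  sol-isolated {D} {κ} {v} {X} {k} free s = record
    { budget  = ≤-trans (m≤n+m _ (count κ (nbrs v X)))
        (≤-trans (≤-reflexive (sym (count-split κ (a v) X))) (≤-trans tail (budget s)))
    ; cluster = λ {w} w∈ kw → let w∈X , vw = ∈-non⁻ X w∈ in
        cluster-non {κ = κ} (trans (adj-sym G w v) vw)
          (λ {x} x∈ vx kx → trans (adj-sym G w x)
            (trans (no-conflict (free x∈ w∈X) vx (separated vx vw)) vw))
          (cluster s (there w∈X) kw) }
    where
    tail : count κ X ≤ count κ (v ∷ X)
    tail with κ v
    ... | true  = n≤1+n _
    ... | false = ≤-refl

  conflict-deleted : ∀ {κ v u w} → Clusters κ → v ≢ w → κ v ≡ false → Confl v u w ≡ true →
    κ u ≡ true ⊎ κ w ≡ true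
  conflict-deleted {κ} {v} {u} {w} cl v≢w kv c with κ u in ku | κ w in kw
  ... | true  | _     = inj₁ refl
  ... | false | true  = inj₂ refl
  ... | false | false with () ← trans (sym c) (cl v≢w kv ku kw)

  -- From certificates to disjoint unions of cliques

  record Family (D : ℕ) (L : List V) (k : ℕ) : Set where
    field
      m       : ℕ
      f       : Fin m → Fin (suc D) → V
      R       : List V
      R-small : length R ≤ k
      inL     : ∀ i x → f i x ∈ L
      -- Not an exclusive or: `R` only bounds the number of deletions. The deletion set will be the
      -- complement of the image of `f`.
      cover   : ∀ {v} → v ∈ L → v ∈ R ⊎ ∃₂ λ i x → f i x ≡ v
      inj     : ∀ {i x j y} → f i x ≡ f j y → (i , x) ≡ (j , y)
      edges   : ∀ i x j y → a (f i x) (f j y) ≡ adj (cliques m (suc D)) (i , x) (j , y)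

  delete : ∀ {D L L′ k} u → (∀ {w} → w ∈ L′ → w ∈ L) → (∀ {w} → w ∈ L → w ≡ u ⊎ w ∈ L′) →
    Family D L′ k → Family D L (suc k)
  delete {L = L} u sub sup F = record
    { m = m ; f = f ; R = u ∷ R ; R-small = s≤s R-small ; inL = λ i x → sub (inL i x)
    ; cover = cover′ ; inj = inj ; edges = edges }
    where
    open Family F
    cover′ : ∀ {w} → w ∈ L → w ∈ u ∷ R ⊎ ∃₂ λ i x → f i x ≡ w
    cover′ w∈ with sup w∈
    ... | inj₁ refl = inj₁ (here refl)
    ... | inj₂ w∈′ with cover w∈′
    ... | inj₁ w∈R = inj₁ (there w∈R)
    ... | inj₂ im  = inj₂ im

  module _ {v X} (free : Free v X) where

    clique-adj : ∀ {u w} → u ∈ v ∷ nbrs v X → w ∈ v ∷ nbrs v X → u ≢ w → a u w ≡ true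
    clique-adj (here refl) (here refl) ne = contradiction refl ne
    clique-adj (here refl) (there w∈) ne = proj₂ (∈-filterᵇ⁻ (a v) {xs = X} w∈)
    clique-adj (there u∈) (here refl) ne = trans (adj-sym G _ v) (proj₂ (∈-filterᵇ⁻ (a v) {xs = X} u∈))
    clique-adj (there u∈) (there w∈) ne =
      let u∈X , vu = ∈-filterᵇ⁻ (a v) {xs = X} u∈
          w∈X , vw = ∈-filterᵇ⁻ (a v) {xs = X} w∈
      in trans (no-conflict (free u∈X w∈X) vu ne) vw

    non-adj : ∀ {w} → w ∈ non v X → a v w ≡ false
    non-adj w∈ = proj₂ (∈-non⁻ X w∈)

    cross-adj : ∀ {u w} → u ∈ v ∷ nbrs v X → w ∈ non v X → a u w ≡ false
    cross-adj (here refl) w∈ = non-adj w∈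
    cross-adj (there u∈) w∈ =
      let u∈X , vu = ∈-filterᵇ⁻ (a v) {xs = X} u∈
          w∈X , _ = ∈-non⁻ X w∈
      in trans (no-conflict (free u∈X w∈X) vu (separated vu (non-adj w∈))) (non-adj w∈)

    cross-≢ : ∀ {u w} → Unique (v ∷ X) → u ∈ v ∷ nbrs v X → w ∈ non v X → u ≢ w
    cross-≢ (v∉X ∷ _) (here refl) w∈ = All.lookup v∉X (proj₁ (∈-non⁻ X w∈))
    cross-≢ _ (there u∈) w∈ = separated (proj₂ (∈-filterᵇ⁻ (a v) {xs = X} u∈)) (non-adj w∈)

  cert-family : ∀ {D L k} → Unique L → Cert D L k → Family D L k
  cert-family uq done = record
    { m = 0 ; f = λ () ; R = [] ; R-small = z≤n ; inL = λ () ; cover = λ ()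
    ; inj = λ { {()} } ; edges = λ () }
  cert-family (_ ∷ uq) (skip {v} c) = delete v there (λ { (here eq) → inj₁ eq ; (there w∈) → inj₂ w∈ })
    (cert-family uq c)
  cert-family {L = v ∷ X} (v∉X ∷ uq) (del u u∈ c) = delete u sub sup
    (cert-family (All.tabulate (λ x∈ → All.lookup v∉X (proj₁ (∈-rem⁻ u X x∈))) ∷ rem-unique u uq) c)
    where
    sub : ∀ {w} → w ∈ v ∷ rem u X → w ∈ v ∷ X
    sub (here eq)  = here eq
    sub (there w∈) = there (proj₁ (∈-rem⁻ u X w∈))
    sup : ∀ {w} → w ∈ v ∷ X → w ≡ u ⊎ w ∈ v ∷ rem u X
    sup (here eq) = inj₂ (here eq)
    sup {w} (there w∈) with u ≟ w
    ... | yes refl = inj₁ refl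
    ... | no u≢w   = inj₂ (there (∈-rem⁺ u w∈ u≢w))
  cert-family {L = v ∷ X} {k} uq@(v∉X ∷ uqX) (clq free refl c) = record
    { m = suc m ; f = f′ ; R = R ; R-small = R-small ; inL = inL′ ; cover = cover′
    ; inj = inj′ ; edges = edges′ }
    where
    open Family (cert-family (filterᵇ-unique (not ∘ a v) uqX) c)
    -- Matching on `refl` has replaced `D` by the degree of `v`, so the positions in `Q` are exactly
    -- the indices of the new clique.
    Q : List V
    Q = v ∷ nbrs v X
    Q-unique : Unique Q
    Q-unique = All.tabulate (λ x∈ → All.lookup v∉X (proj₁ (∈-filterᵇ⁻ (a v) {xs = X} x∈)))
             ∷ filterᵇ-unique (a v) uqX
    f′ : Fin (suc m) → Fin (length Q) → V
    f′ zero    x = lookup Q x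
    f′ (suc i) x = f i x
    inQ : ∀ x → lookup Q x ∈ Q
    inQ = ∈-lookup
    inL′ : ∀ i x → f′ i x ∈ v ∷ X
    inL′ zero zero = here refl
    inL′ zero (suc x) = there (proj₁ (∈-filterᵇ⁻ (a v) {xs = X} (∈-lookup x)))
    inL′ (suc i) x = there (proj₁ (∈-non⁻ X (inL i x)))
    cover′ : ∀ {w} → w ∈ v ∷ X → w ∈ R ⊎ ∃₂ λ i x → f′ i x ≡ w
    cover′ (here refl) = inj₂ (zero , zero , refl)
    cover′ {w} (there w∈) with a v w in vw
    ... | true = let w∈N = ∈-filterᵇ⁺ (a v) w∈ vw in
      inj₂ (zero , suc (Any.index w∈N) , sym (lookup-index w∈N))
    ... | false with cover (∈-filterᵇ⁺ (not ∘ a v) w∈ (cong not vw))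
    ... | inj₁ w∈R = inj₁ w∈R
    ... | inj₂ (i , x , eq) = inj₂ (suc i , x , eq)
    inj′ : ∀ {i x j y} → f′ i x ≡ f′ j y → (i , x) ≡ (j , y)
    inj′ {zero} {x} {zero} {y} eq = cong (zero ,_) (lookup-injective Q-unique eq)
    inj′ {zero} {x} {suc j} {y} eq = contradiction eq (cross-≢ free uq (inQ x) (inL j y))
    inj′ {suc i} {x} {zero} {y} eq = contradiction (sym eq) (cross-≢ free uq (inQ y) (inL i x))
    inj′ {suc i} {x} {suc j} {y} eq with inj eq
    ... | refl = refl
    edges′ : ∀ i x j y → a (f′ i x) (f′ j y) ≡ adj (cliques (suc m) (length Q)) (i , x) (j , y)
    edges′ zero x zero y with x ≟ y
    ... | yes refl = adj-irr G _
    ... | no x≢y = clique-adj free (inQ x) (inQ y) (x≢y ∘ lookup-injective Q-unique)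
    edges′ zero x (suc j) y = cross-adj free (inQ x) (inL j y)
    edges′ (suc i) x zero y = trans (adj-sym G _ _) (cross-adj free (inQ y) (inL i x))
    edges′ (suc i) x (suc j) y = edges i x j y

  -- Translation to and from `UCVD`

  ∣tabulate∣ : ∀ {A : Set} {m} (p : A → Bool) (g : Fin m → A) →
    ∣ Vec.tabulate (p ∘ g) ∣ ≡ count p (tabulate g)
  ∣tabulate∣ {m = zero}  p g = refl
  ∣tabulate∣ {m = suc m} p g with p (g zero)
  ... | true  = cong suc (∣tabulate∣ p (g ∘ suc))
  ... | false = ∣tabulate∣ p (g ∘ suc)

  kept⇒∈∁ : ∀ (S : Subset n) {v} → S ‼ v ≡ false → v Subset.∈ ∁ S
  kept⇒∈∁ S {v} eq = Vecₚ.lookup⇒[]= v (∁ S) (trans (Vecₚ.lookup-map v not S) (cong not eq))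

  ∈∁⇒kept : ∀ (S : Subset n) {v} → v Subset.∈ ∁ S → S ‼ v ≡ false
  ∈∁⇒kept S {v} v∈ = not-injective (trans (sym (Vecₚ.lookup-map v not S)) (Vecₚ.[]=⇒lookup v∈))

  kept-≡ : ∀ (S : Subset n) {v w} {p : v Subset.∈ ∁ S} {q : w Subset.∈ ∁ S} →
    v ≡ w → (v , p) ≡ (w , q)
  kept-≡ S refl = cong (_ ,_) (Vecₚ.[]=-irrelevant _ _)

  -- Deleting the complement of the image of `f` makes the remaining vertices exactly that image. By
  -- `cover` this complement lies within `R`, which bounds its size.
  UCVD-sound : ∀ {D k} → Cert D (allFin n) k → UCVD G k
  UCVD-sound {D} {k} c = S , small , m , suc D , record
    { bijection = mk↔ₛ′ to from to∘from from∘to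
    ; adj-pres  = λ u v → trans (cong₂ a (sym (to-f u)) (sym (to-f v))) (edges _ _ _ _) }
    where
    open Family (cert-family (allFin⁺ n) c)
    image? : ∀ v → Dec (∃₂ λ i x → f i x ≡ v)
    image? v = any? λ i → any? λ x → f i x ≟ v
    deleted : V → Bool
    deleted v = not (does (image? v))
    S : Subset n
    S = Vec.tabulate deleted
    S‼ : ∀ v → S ‼ v ≡ deleted v
    S‼ v = Vecₚ.lookup∘tabulate deleted v
    small : ∣ S ∣ ≤ k
    small = ≤-trans (≤-reflexive (∣tabulate∣ deleted id)) (≤-trans
      (length-mono (filterᵇ-unique deleted (allFin⁺ n)) in-R) R-small)
      where
      in-R : ∀ {v} → v ∈ filterᵇ deleted (allFin n) → v ∈ R
      in-R {v} v∈ with ∈-filterᵇ⁻ deleted {xs = allFin n} v∈ | cover (∈-allFin v)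
      ... | _ , _  | inj₁ v∈R = v∈R
      ... | _ , dv | inj₂ im with () ← trans (sym dv) (cong not (dec-true (image? v) im))
    image : ∀ {v} → v Subset.∈ ∁ S → ∃₂ λ i x → f i x ≡ v
    image {v} v∈ with image? v | trans (sym (S‼ v)) (∈∁⇒kept S v∈)
    ... | yes im | _ = im
    to : (∃ λ v → v Subset.∈ ∁ S) → Fin m × Fin (suc D)
    to (v , v∈) = let i , x , _ = image v∈ in i , x
    to-f : ∀ u → f (proj₁ (to u)) (proj₂ (to u)) ≡ proj₁ u
    to-f (v , v∈) = let _ , _ , eq = image v∈ in eq
    from : Fin m × Fin (suc D) → ∃ λ v → v Subset.∈ ∁ S
    from (i , x) = f i x , kept⇒∈∁ S (trans (S‼ _) (cong not (dec-true (image? (f i x)) (i , x , refl))))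
    to∘from : ∀ ix → to (from ix) ≡ ix
    to∘from ix = inj (to-f (from ix))
    from∘to : ∀ u → from (to u) ≡ u
    from∘to u = kept-≡ S (to-f u)

  -- The bound on `D` makes the guess of the cluster size a finite search.
  UCVD-complete : ∀ {k} → UCVD G k →
    ∃[ D ] D ≤ n × ∃[ κ ] Clusters κ × Sol D κ (allFin n) k
  UCVD-complete {k} (S , small , m , d , iso) = choose m d iso
    where
    κ : V → Bool
    κ = S ‼_
    budget′ : count κ (allFin n) ≤ k
    budget′ = ≤-trans (≤-reflexive (trans (sym (∣tabulate∣ κ id))
      (cong ∣_∣ (Vecₚ.tabulate∘lookup S)))) small

    module Iso {m d} (iso : (G - S) ≅ cliques m d) where
      open Inverse (_≅_.bijection iso) using (to; from; strictlyInverseˡ; strictlyInverseʳ)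
      label : ∀ {v} → κ v ≡ false → Fin m × Fin d
      label kv = to (_ , kept⇒∈∁ S kv)
      vertex : Fin m × Fin d → V
      vertex ix = proj₁ (from ix)
      vertex-kept : ∀ ix → κ (vertex ix) ≡ false
      vertex-kept ix = ∈∁⇒kept S (proj₂ (from ix))
      label-vertex : ∀ ix → label (vertex-kept ix) ≡ ix
      label-vertex ix = trans (cong to (kept-≡ S refl)) (strictlyInverseˡ ix)
      vertex-label : ∀ {v} (kv : κ v ≡ false) → vertex (label kv) ≡ v
      vertex-label kv = cong proj₁ (strictlyInverseʳ _)
      edge : ∀ {v w} (kv : κ v ≡ false) (kw : κ w ≡ false) →
        a v w ≡ adj (cliques m d) (label kv) (label kw)
      edge kv kw = _≅_.adj-pres iso (_ , kept⇒∈∁ S kv) (_ , kept⇒∈∁ S kw)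
      label-injective : ∀ {v w} (kv : κ v ≡ false) (kw : κ w ≡ false) → label kv ≡ label kw → v ≡ w
      label-injective kv kw eq = trans (sym (vertex-label kv)) (trans (cong vertex eq) (vertex-label kw))

      clusters : Clusters κ
      clusters {v} {u} {w} v≢w kv ku kw with u ≟ w
      ... | yes _  = ∧-zeroʳ (a v u)
      ... | no u≢w rewrite edge kv ku | edge ku kw | edge kv kw =
        no-path (label kv) (label ku) (label kw) (v≢w ∘ label-injective kv kw)
          (u≢w ∘ label-injective ku kw)
        where
        -- Lying in the same clique is transitive and `r` differs from both other vertices, so `p`
        -- and `q` see `r` alike as soon as they share a clique.
        no-path : ∀ p q r → p ≢ r → q ≢ r →
          adj (cliques m d) p q ∧ (adj (cliques m d) q r xor adj (cliques m d) p r) ≡ false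
        no-path (i , x) (j , y) (l , z) p≢r q≢r with i ≟ j
        ... | no _ = refl
        ... | yes refl with i ≟ l
        ... | no _ = ∧-zeroʳ _
        ... | yes refl with x ≟ z | y ≟ z
        ... | yes refl | _ = contradiction refl p≢r
        ... | no _ | yes refl = contradiction refl q≢r
        ... | no _ | no _ = ∧-zeroʳ _

    -- `g` enumerates the other vertices of the clique of `v`, with `punchIn` skipping the position
    -- of `v` itself. Inclusions both ways between its range and the kept neighbours give the count.
    cluster-size : ∀ {m D} (iso : (G - S) ≅ cliques m (suc D)) {v} → κ v ≡ false →
      count (kept κ v) (allFin n) ≡ D
    cluster-size {m} {D} iso {v} kv = ≤-antisym
      (≤-trans (length-mono (filterᵇ-unique (kept κ v) (allFin⁺ n)) sub)
        (≤-reflexive (length-tabulate g)))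
      (≤-trans (≤-reflexive (sym (length-tabulate g))) (length-mono (tabulate⁺ g-injective) sup))
      where
      open Iso iso
      i = proj₁ (label kv)
      x = proj₂ (label kv)
      g : Fin D → V
      g y = vertex (i , punchIn x y)
      g-injective : ∀ {y z} → g y ≡ g z → y ≡ z
      g-injective {y} {z} eq = punchIn-injective x y z (cong proj₂ (trans (sym (label-vertex _))
        (trans (cong to (kept-≡ S eq)) (label-vertex _))))
        where open Inverse (_≅_.bijection iso) using (to)
      sub : ∀ {w} → w ∈ filterᵇ (kept κ v) (allFin n) → w ∈ tabulate g
      sub {w} w∈ with ∈-filterᵇ⁻ (kept κ v) {xs = allFin n} w∈
      ... | _ , vw with κ w in kw
      sub {w} w∈ | _ , vw | true with () ← trans (sym vw) (∧-zeroʳ (a v w))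
      sub {w} w∈ | _ , vw | false = adjacent refl (trans (sym (edge kv kw)) (∧-true vw))
        where
        ∧-true : ∀ {b} → b ∧ true ≡ true → b ≡ true
        ∧-true {true} _ = refl
        adjacent : ∀ {p} → label kw ≡ p → adj (cliques m (suc D)) (i , x) (label kw) ≡ true →
          w ∈ tabulate g
        adjacent {j , y} eq e rewrite eq with i ≟ j | x ≟ y
        ... | yes refl | no x≢y = subst (_∈ tabulate g)
          (trans (cong (λ y → vertex (i , y)) (punchIn-punchOut x≢y))
            (trans (cong vertex (sym eq)) (vertex-label kw)))
          (∈-tabulate⁺ (punchOut x≢y))
      sup : ∀ {w} → w ∈ tabulate g → w ∈ filterᵇ (kept κ v) (allFin n)
      sup w∈ with ∈-tabulate⁻ w∈
      ... | y , refl = ∈-filterᵇ⁺ (kept κ v) (∈-allFin _) (cong₂ _∧_ adjacent (cong not (vertex-kept _)))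
        where
        adjacent : a v (g y) ≡ true
        adjacent = trans (edge kv (vertex-kept _))
          (trans (cong (adj (cliques m (suc D)) (label kv)) (label-vertex _))
            (cong₂ _∧_ (dec-true (i ≟ i) refl)
              (cong not (dec-false (x ≟ punchIn x y) (λ eq → punchInᵢ≢i x y (sym eq))))))

    choose : ∀ m d → (G - S) ≅ cliques m d → ∃[ D ] D ≤ n × ∃[ κ ] Clusters κ × Sol D κ (allFin n) k
    -- If `m` or `d` is zero, then `cliques m d` has no vertices. Everything is deleted, and D = 0
    -- satisfies `cluster` vacuously.
    choose m zero iso = 0 , z≤n , κ , clusters , record
      { budget = budget′ ; cluster = λ _ kv → ⊥-elim (¬Fin0 (proj₂ (label kv))) }
      where open Iso iso
    choose zero (suc D) iso = 0 , z≤n , κ , clusters , record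
      { budget = budget′ ; cluster = λ _ kv → ⊥-elim (¬Fin0 (proj₁ (label kv))) }
      where open Iso iso
    choose (suc m) (suc D) iso = D , D≤n , κ , clusters , record
      { budget = budget′ ; cluster = λ _ → cluster-size iso }
      where
      open Iso iso
      D≤n : D ≤ n
      D≤n = ≤-trans (≤-reflexive (sym (cluster-size iso (vertex-kept (zero , zero)))))
        (≤-trans (count≤length _ (allFin n)) (≤-reflexive (length-tabulate id)))

-- The program

pattern lookupᶠ = 0F
pattern adjᶠ    = 1F
pattern eqᶠ     = 2F
pattern sameᶠ   = 3F
pattern nbrsᶠ   = 4F
pattern nonᶠ    = 5F
pattern remᶠ    = 6F
pattern conflᶠ  = 7F
pattern confWᶠ  = 8F
pattern confUᶠ  = 9F
pattern 10F     = suc 9F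
pattern 11F     = suc 10F
pattern fixᶠ    = 10F
pattern subᶠ    = 11F
pattern planᶠ   = suc subᶠ
pattern isoᶠ    = suc planᶠ
pattern keepᶠ   = suc isoᶠ
pattern solveᶠ  = suc keepᶠ
pattern tryᶠ    = suc solveᶠ
pattern mkᶠ     = suc tryᶠ

arities : Fin 18 → ℕ
arities lookupᶠ = 2
arities adjᶠ    = 2
arities eqᶠ     = 2
arities sameᶠ   = 2
arities nbrsᶠ   = 2
arities nonᶠ    = 2
arities remᶠ    = 2
arities conflᶠ  = 3
arities confWᶠ  = 3
arities confUᶠ  = 3
arities fixᶠ    = 3
arities subᶠ    = 2
arities planᶠ   = 3
arities isoᶠ    = 1
arities keepᶠ   = 4
arities solveᶠ  = 3
arities tryᶠ    = 3
arities mkᶠ     = 2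

Code : ℕ → Set
Code = Exp arities

invoke : ∀ {m} (f : Fin 18) → Vec (Fin m) (arities f) → Code m
invoke f xs = call f (Vec.map var xs)

yes! : ∀ {m} → Code m
yes! = cons nil nil

not! : ∀ {m} → Code m → Code m
not! e = match e yes! nil

-- The environments are listed in braces, variable 0 first; _ marks an unused variable.

-- {X v}; t runs in {rest x _ _ v}.
filterCode : Code 4 → Code 5 → Code 2
filterCode again t = match (var 0F) nil (bind again (match t (var 0F) (cons (var 3F) (var 2F))))

-- {Us p q}; t runs in {u us _ p q} and again in {_ _ us _ p q}.
firstCode : Code 6 → Code 5 → Code 3
firstCode again t = match (var 0F) nil (bind t (match (var 0F) again (var 2F)))

code : ∀ f → Code (arities f)
-- {i r}
code lookupᶠ = match (var 1F) nil (match (var 2F) (var 0F) (invoke lookupᶠ (1F ∷ 3F ∷ [])))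
-- {u w}
code adjᶠ = match (var 0F) nil (match (var 3F) nil (invoke lookupᶠ (0F ∷ 3F ∷ [])))
-- {i j}
code eqᶠ = match (var 0F) (match (var 1F) yes! nil) (match (var 3F) nil (invoke eqᶠ (3F ∷ 1F ∷ [])))
-- {u w}
code sameᶠ = match (var 0F) nil (match (var 3F) nil (invoke eqᶠ (2F ∷ 0F ∷ [])))
code nbrsᶠ = filterCode (invoke nbrsᶠ (1F ∷ 3F ∷ [])) (invoke adjᶠ (4F ∷ 1F ∷ []))
code nonᶠ = filterCode (invoke nonᶠ (1F ∷ 3F ∷ [])) (not! (invoke adjᶠ (4F ∷ 1F ∷ [])))
code remᶠ = filterCode (invoke remᶠ (1F ∷ 3F ∷ [])) (not! (invoke sameᶠ (4F ∷ 1F ∷ [])))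
-- {v u w}
code conflᶠ = match (invoke adjᶠ (0F ∷ 1F ∷ [])) nil
  (match (invoke sameᶠ (3F ∷ 4F ∷ []))
    (match (invoke adjᶠ (3F ∷ 4F ∷ [])) (invoke adjᶠ (2F ∷ 4F ∷ []))
      (not! (invoke adjᶠ (4F ∷ 6F ∷ []))))
    nil)
-- {X v u}
code confWᶠ = firstCode (invoke confWᶠ (2F ∷ 4F ∷ 5F ∷ []))
  (match (invoke conflᶠ (3F ∷ 4F ∷ 0F ∷ [])) nil (cons (var 6F) (var 2F)))
-- {Us v X}
code confUᶠ = firstCode (invoke confUᶠ (2F ∷ 4F ∷ 5F ∷ []))
  (invoke confWᶠ (4F ∷ 3F ∷ 0F ∷ []))
-- {Us v X}
code fixᶠ = firstCode (invoke fixᶠ (2F ∷ 4F ∷ 5F ∷ []))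
  (bind (invoke remᶠ (4F ∷ 0F ∷ [])) (not! (invoke confUᶠ (0F ∷ 4F ∷ 0F ∷ []))))
-- {a b}
code subᶠ = match (var 1F) (cons (var 0F) nil) (match (var 2F) nil (invoke subᶠ (1F ∷ 3F ∷ [])))
-- {v X D}
code planᶠ =
  bind (invoke nbrsᶠ (1F ∷ 0F ∷ [])) (                        -- {N v X D}
  bind (invoke subᶠ (0F ∷ 3F ∷ [])) (                         -- {_ N v X D}
  match (var 0F) nil (                                        -- {e _ _ N v X D}
  bind (invoke confUᶠ (5F ∷ 4F ∷ 5F ∷ [])) (                  -- {c e _ _ N v X D}
  match (var 0F) (cons nil (var 1F)) (                        -- {_ _ c e _ _ N v X D}
  match (var 3F) (cons (var 2F) (var 3F)) (                   -- {_ _ _ _ c e _ _ N v X D}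
  match (invoke fixᶠ (8F ∷ 9F ∷ 10F ∷ [])) (cons (var 4F) (var 5F))
  (cons nil (var 7F))))))))
-- {P}
code isoᶠ = match (var 0F) nil (match (var 0F) (match (var 1F) yes! nil) nil)
-- {v X D k}
code keepᶠ =
  bind (invoke planᶠ (0F ∷ 1F ∷ 2F ∷ [])) (
  match (var 0F) nil (                                        -- {c e _ v X D k}
  match (var 0F)
    (bind (invoke subᶠ (6F ∷ 1F ∷ [])) (
     match (var 0F) nil (                                     -- {k′ _ _ _ _ _ v X D k}
     bind (invoke nonᶠ (7F ∷ 6F ∷ [])) (                      -- {R k′ _ _ _ _ _ v X D k}
     invoke solveᶠ (0F ∷ 9F ∷ 1F ∷ [])))))
    (match (var 8F) nil (                                     -- {_ k′ u w _ _ _ v X D k}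
     bind (invoke remᶠ (8F ∷ 2F ∷ [])) (                      -- {X′ _ k′ u w _ _ _ v X D k}
     match (invoke keepᶠ (8F ∷ 0F ∷ 10F ∷ 2F ∷ []))
       (bind (invoke remᶠ (9F ∷ 4F ∷ [])) (                   -- {X″ _ _ k′ u w _ _ _ v X D k}
        invoke keepᶠ (9F ∷ 0F ∷ 11F ∷ 3F ∷ [])))
       yes!)))))
-- {L D k}
code solveᶠ = match (var 0F) yes! (                           -- {v X _ D k}
  bind (invoke planᶠ (0F ∷ 1F ∷ 3F ∷ [])) (                   -- {P v X _ D k}
  match (invoke isoᶠ (0F ∷ []))
    (match (invoke keepᶠ (1F ∷ 2F ∷ 4F ∷ 5F ∷ []))
      (match (var 5F) nil (invoke solveᶠ (4F ∷ 6F ∷ 1F ∷ [])))  -- {_ k′ P v X _ D k}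
      yes!)
    (bind (invoke nonᶠ (4F ∷ 3F ∷ [])) (                      -- {R _ _ P v X _ D k}
     invoke solveᶠ (0F ∷ 7F ∷ 8F ∷ [])))))
-- {D L k}
code tryᶠ = match (invoke solveᶠ (1F ∷ 0F ∷ 2F ∷ []))
  (match (var 0F) nil (invoke tryᶠ (1F ∷ 3F ∷ 4F ∷ []))) yes!
-- {i rows}
code mkᶠ = match (var 1F) nil (                               -- {row rows i _}
  bind (cons nil (var 2F)) (                                  -- {i+1 row rows i _}
  cons (cons (var 3F) (var 1F)) (invoke mkᶠ (0F ∷ 2F ∷ []))))

program : Program 2
program = record
  { size  = 18
  ; arity = arities
  ; body  = code
  -- The vertex list is passed twice: as the list to solve and, read as a unary number, as the
  -- starting value n of `D`.
  ; main  = bind nil (bind (invoke mkᶠ (0F ∷ 1F ∷ [])) (invoke tryᶠ (0F ∷ 0F ∷ 3F ∷ [])))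
  }

-- Running times and correctness

open Semantics code

record Run {m} (ρ : Vec Val m) (e : Code m) (v : Val) (T : ℕ) : Set where
  constructor run
  field
    {steps} : ℕ
    eval    : ρ ⊢ e ⇓ v ∣ steps
    within  : steps ≤ T

module _ {m} {ρ : Vec Val m} where

  weaken : ∀ {e v T T′} → T ≤ T′ → Run ρ e v T → Run ρ e v T′
  weaken le (run d w) = run d (≤-trans w le)

  var! : ∀ x → Run ρ (var x) (Vec.lookup ρ x) 1
  var! x = run (var x) ≤-refl

  nil! : Run ρ nil nil 1
  nil! = run nil ≤-refl

  cons! : ∀ {e₁ e₂ v₁ v₂ T₁ T₂} → Run ρ e₁ v₁ T₁ → Run ρ e₂ v₂ T₂ →
    Run ρ (cons e₁ e₂) (cons v₁ v₂) (suc (T₁ + T₂))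
  cons! (run d₁ w₁) (run d₂ w₂) = run (cons d₁ d₂) (s≤s (+-mono-≤ w₁ w₂))

  bind! : ∀ {e b u v T₁ T₂} → Run ρ e u T₁ → Run (u ∷ ρ) b v T₂ → Run ρ (bind e b) v (suc (T₁ + T₂))
  bind! (run d₁ w₁) (run d₂ w₂) = run (bind d₁ d₂) (s≤s (+-mono-≤ w₁ w₂))

  match-nil! : ∀ {e a b v T₁ T₂} → Run ρ e nil T₁ → Run ρ a v T₂ → Run ρ (match e a b) v (suc (T₁ + T₂))
  match-nil! (run d₁ w₁) (run d₂ w₂) = run (match-nil d₁ d₂) (s≤s (+-mono-≤ w₁ w₂))

  match-cons! : ∀ {e a b v v₁ v₂ T₁ T₂} → Run ρ e (cons v₁ v₂) T₁ → Run (v₁ ∷ v₂ ∷ ρ) b v T₂ →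
    Run ρ (match e a b) v (suc (T₁ + T₂))
  match-cons! (run d₁ w₁) (run d₂ w₂) = run (match-cons d₁ d₂) (s≤s (+-mono-≤ w₁ w₂))

  args : ∀ {j} (xs : Vec (Fin m) j) → ρ ⊢* Vec.map var xs ⇓ Vec.map (Vec.lookup ρ) xs ∣ j
  args []       = []
  args (x ∷ xs) = var x ∷ args xs

  call! : ∀ f xs {v T} → Run (Vec.map (Vec.lookup ρ) xs) (code f) v T →
    Run ρ (invoke f xs) v (suc (arities f + T))
  call! f xs (run d w) = run (call (args xs) d) (s≤s (+-monoʳ-≤ (arities f) w))

  yes!! : Run ρ yes! (cons nil nil) 3
  yes!! = cons! nil! nil!

not!! : ∀ {m} {ρ : Vec Val m} {e T} c → Run ρ e (encodeBool c) T →
  Run ρ (not! e) (encodeBool (not c)) (suc (T + 3))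
not!! false r = match-nil! r yes!!
not!! {T = T} true r = weaken (s≤s (+-monoʳ-≤ T (s≤s z≤n))) (match-cons! r nil!)

-- Any value serves as a unary number, its heads being ignored. So a list stands for its own length:
-- `D` and the surplus are suffixes of vertex lists.
len : Val → ℕ
len nil        = 0
len (cons _ v) = suc (len v)

by-slack : ∀ {m n} s → m + s ≡ n → m ≤ n
by-slack s eq = ≤-trans (m≤m+n _ s) (≤-reflexive eq)

-- Seven steps per level: two matches on variables and a call with two arguments. The additive
-- constants of `lookupT` and `eqT` are the cost of stopping; the leading 7 of `adjT` and `sameT` is
-- one more such level.
lookupT eqT adjT sameT : ℕ → ℕ
lookupT n = n * 7 + 5
eqT n = n * 7 + 7
adjT n = 7 + lookupT n
sameT n = 7 + eqT n

lookup-run : ∀ {m} (f : Fin m → Bool) i →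
  Run (encodeℕ (toℕ i) ∷ encodeList (tabulate (λ j → encodeBool (f j))) ∷ []) (code lookupᶠ)
    (encodeBool (f i)) (lookupT (toℕ i))
lookup-run f zero    = match-cons! (var! 1F) (match-nil! (var! 2F) (var! 0F))
lookup-run f (suc i) = match-cons! (var! 1F) (match-cons! (var! 2F)
  (call! lookupᶠ (1F ∷ 3F ∷ []) (lookup-run (f ∘ suc) i)))

eq-run : ∀ {m} (i j : Fin m) →
  Run (encodeℕ (toℕ i) ∷ encodeℕ (toℕ j) ∷ []) (code eqᶠ) (encodeBool (does (i ≟ j))) (eqT (toℕ i))
eq-run zero    zero    = match-nil! (var! 0F) (match-nil! (var! 1F) yes!!)
eq-run zero    (suc j) = weaken (m≤n+m 5 2) (match-nil! (var! 0F) (match-cons! (var! 1F) nil!))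
eq-run (suc i) zero    = weaken (s≤s (s≤s (s≤s (s≤s (s≤s z≤n)))))
  (match-cons! (var! 0F) (match-nil! (var! 3F) nil!))
eq-run (suc i) (suc j) = match-cons! (var! 0F) (match-cons! (var! 3F)
  (call! eqᶠ (3F ∷ 1F ∷ []) (eq-run i j)))

data Outcome (P : Set) (R : Val → Val → Set) : Val → Set where
  none : P → Outcome P R nil
  some : ∀ {h t} → R h t → Outcome P R (cons h t)

-- The difference may itself be `nil`, so success wraps it in a pair to keep it apart from failure.
data Sub (a b : Val) : Val → Set where
  short : len a < len b → Sub a b nil
  rest  : ∀ e → len a ≡ len e + len b → Sub a b (cons e nil)

subT : ℕ → ℕ
subT m = m * 7 + 5

subT-mono : ∀ {m m′} → m ≤ m′ → subT m ≤ subT m′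
subT-mono le = +-monoˡ-≤ 5 (*-monoˡ-≤ 7 le)

sub-run : ∀ a b → ∃[ r ] Run (a ∷ b ∷ []) (code subᶠ) r (subT (len b)) × Sub a b r
sub-run a nil = _ , match-nil! (var! 1F) (cons! (var! 0F) nil!) , rest a (sym (+-identityʳ _))
sub-run nil (cons _ b) = _ , weaken (s≤s (s≤s (s≤s (s≤s (s≤s z≤n)))))
  (match-cons! (var! 1F) (match-nil! (var! 2F) nil!)) , short (s≤s z≤n)
sub-run (cons _ a) (cons _ b) with sub-run a b
... | _ , r , s = _ , match-cons! (var! 1F) (match-cons! (var! 2F) (call! subᶠ (1F ∷ 3F ∷ []) r)) , lift s
  where
  lift : ∀ {h h′ r} → Sub a b r → Sub (cons h a) (cons h′ b) r
  lift (short lt)  = short (s≤s lt)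
  lift (rest e eq) = rest e (trans (cong suc eq) (sym (+-suc _ _)))

filterT firstT : ℕ → ℕ → ℕ
filterT C m = m * (10 + C) + 3
firstT C m = m * (9 + C) + 3

mkT : ℕ → ℕ
mkT m = m * 13 + 3

-- Opacity turns these deeply nested bounds into atoms for all later arithmetic; the inequalities
-- below are their interface until `bounded-stepT` unfolds them. They depend on n alone, because
-- every list handled has length at most n.
opaque
  conflT nbrsT nonT remT confWT confUT fixT planT : ℕ → ℕ
  conflT n = 4 * (3 + adjT n) + (3 + sameT n) + 20
  nbrsT n  = filterT (3 + adjT n) n
  nonT n   = filterT (suc (3 + adjT n + 3)) n
  remT n   = filterT (suc (3 + sameT n + 3)) n
  confWT n = firstT (suc (4 + conflT n + 3)) n
  confUT n = firstT (4 + confWT n) n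
  fixT n   = firstT (suc (3 + remT n + suc (4 + confUT n + 3))) n
  planT n  = (3 + nbrsT n) + (3 + subT n) + (4 + confUT n) + (4 + fixT n) + 20

  filterT-mono : ∀ {C m m′} → m ≤ m′ → filterT C m ≤ filterT C m′
  filterT-mono {C} le = +-monoˡ-≤ 3 (*-monoˡ-≤ (10 + C) le)

  firstT-mono : ∀ {C m m′} → m ≤ m′ → firstT C m ≤ firstT C m′
  firstT-mono {C} le = +-monoˡ-≤ 3 (*-monoˡ-≤ (9 + C) le)

  conflT≥ : ∀ n → 4 * (3 + adjT n) + (3 + sameT n) + 20 ≤ conflT n
  conflT≥ n = ≤-refl

  nbrsT≥ : ∀ {n m} → m ≤ n → filterT (3 + adjT n) m ≤ nbrsT n
  nbrsT≥ {n} = filterT-mono {3 + adjT n}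

  nonT≥ : ∀ {n m} → m ≤ n → filterT (suc (3 + adjT n + 3)) m ≤ nonT n
  nonT≥ {n} = filterT-mono {suc (3 + adjT n + 3)}

  remT≥ : ∀ {n m} → m ≤ n → filterT (suc (3 + sameT n + 3)) m ≤ remT n
  remT≥ {n} = filterT-mono {suc (3 + sameT n + 3)}

  confWT≥ : ∀ {n m} → m ≤ n → firstT (suc (4 + conflT n + 3)) m ≤ confWT n
  confWT≥ {n} = firstT-mono {suc (4 + conflT n + 3)}

  confUT≥ : ∀ {n m} → m ≤ n → firstT (4 + confWT n) m ≤ confUT n
  confUT≥ {n} = firstT-mono {4 + confWT n}

  fixT≥ : ∀ {n m} → m ≤ n → firstT (suc (3 + remT n + suc (4 + confUT n + 3))) m ≤ fixT n
  fixT≥ {n} = firstT-mono {suc (3 + remT n + suc (4 + confUT n + 3))}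

  planT≥ : ∀ n → (3 + nbrsT n) + (3 + subT n) + (4 + confUT n) + (4 + fixT n) + 20 ≤ planT n
  planT≥ n = ≤-refl

-- Bounds one activation of keepᶠ or solveᶠ without its recursive calls.
stepT : ℕ → ℕ
stepT n = planT n + nonT n + 2 * remT n + subT n + 60

module Runs {n : ℕ} (G : Graph (Fin n)) where
  open Combinatorics G

  -- A vertex carries its own adjacency row, so adjacency is decided from the two vertices without
  -- access to the matrix. The index serves to look into rows and to compare vertices.
  encV : V → Val
  encV v = cons (encodeℕ (toℕ v)) (encodeList (tabulate λ w → encodeBool (a v w)))

  enc : List V → Val
  enc X = encodeList (List.map encV X)

  len-enc : ∀ X → len (enc X) ≡ length X
  len-enc []      = refl
  len-enc (x ∷ X) = cong suc (len-enc X)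

  mk-run : ∀ {m} (g : Fin m → V) i → (∀ j → toℕ (g j) ≡ i + toℕ j) →
    Run (encodeℕ i ∷ encodeList (tabulate λ j → encodeList (tabulate λ w → encodeBool (a (g j) w))) ∷ [])
      (code mkᶠ) (enc (tabulate g)) (mkT m)
  mk-run {zero} g i eq = match-nil! (var! 1F) nil!
  mk-run {suc m} g i eq rewrite trans (eq zero) (+-identityʳ i) =
    match-cons! (var! 1F) (bind! (cons! nil! (var! 2F)) (cons! (cons! (var! 3F) (var! 1F))
      (call! mkᶠ (0F ∷ 2F ∷ []) (mk-run (g ∘ suc) (suc i) (λ j → trans (eq (suc j)) (+-suc i (toℕ j)))))))

  index-≤ : ∀ (v : V) → toℕ v * 7 ≤ n * 7
  index-≤ v = *-monoˡ-≤ 7 (<⇒≤ (toℕ<n v))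

  adj-run : ∀ u w → Run (encV u ∷ encV w ∷ []) (code adjᶠ) (encodeBool (a u w)) (adjT n)
  adj-run u w = match-cons! (var! 0F) (match-cons! (var! 3F) (call! lookupᶠ (0F ∷ 3F ∷ [])
    (weaken (+-monoˡ-≤ 5 (index-≤ w)) (lookup-run (a u) w))))

  same-run : ∀ u w → Run (encV u ∷ encV w ∷ []) (code sameᶠ) (encodeBool (does (u ≟ w))) (sameT n)
  same-run u w = match-cons! (var! 0F) (match-cons! (var! 3F) (call! eqᶠ (2F ∷ 0F ∷ [])
    (weaken (+-monoˡ-≤ 7 (index-≤ u)) (eq-run u w))))

  -- `again` stands for the recursive call of a concrete function. The first hypothesis says that it
  -- runs the same filter on the tail at an overhead of 3, one call with two arguments, so a single
  -- induction serves all filters.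
  filter-run : ∀ {again t C p} (q : V → Bool) →
    (∀ {X r T x} → Run (enc X ∷ p ∷ []) (filterCode again t) r T →
      Run (encV x ∷ enc X ∷ enc (x ∷ X) ∷ p ∷ []) again r (3 + T)) →
    (∀ {r xs X} x → Run (r ∷ encV x ∷ xs ∷ X ∷ p ∷ []) t (encodeBool (q x)) C) →
    ∀ X → Run (enc X ∷ p ∷ []) (filterCode again t) (enc (filterᵇ q X)) (filterT C (length X))
  filter-run q rec test [] = match-nil! (var! 0F) nil!
  filter-run {again} {t} {C} {p} q rec test (x ∷ X) = weaken (≤-reflexive (lemma C (length X)))
    (match-cons! (var! 0F) (bind! (rec (filter-run q rec test X)) select))
    where
    select : Run (enc (filterᵇ q X) ∷ encV x ∷ enc X ∷ enc (x ∷ X) ∷ p ∷ [])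
      (match t (var 0F) (cons (var 3F) (var 2F))) (enc (filterᵇ q (x ∷ X))) (suc (C + 3))
    select with q x | test {enc (filterᵇ q X)} {enc X} {enc (x ∷ X)} x
    ... | true  | r = match-cons! r (cons! (var! 3F) (var! 2F))
    ... | false | r = weaken (s≤s (+-monoʳ-≤ C (s≤s z≤n))) (match-nil! r (var! 0F))
    lemma : ∀ C m → suc (1 + suc (3 + (m * (10 + C) + 3) + suc (C + 3))) ≡ suc m * (10 + C) + 3
    lemma = solve-∀

  nbrs-run : ∀ X v → length X ≤ n → Run (enc X ∷ encV v ∷ []) (code nbrsᶠ) (enc (nbrs v X)) (nbrsT n)
  nbrs-run X v X≤n = weaken (nbrsT≥ X≤n) (filter-run (a v)
    (call! nbrsᶠ (1F ∷ 3F ∷ []))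
    (λ x → call! adjᶠ (4F ∷ 1F ∷ []) (adj-run v x)) X)

  non-run : ∀ X v → length X ≤ n → Run (enc X ∷ encV v ∷ []) (code nonᶠ) (enc (non v X)) (nonT n)
  non-run X v X≤n = weaken (nonT≥ X≤n) (filter-run (not ∘ a v)
    (call! nonᶠ (1F ∷ 3F ∷ []))
    (λ x → not!! (a v x) (call! adjᶠ (4F ∷ 1F ∷ []) (adj-run v x))) X)

  rem-run : ∀ X u → length X ≤ n → Run (enc X ∷ encV u ∷ []) (code remᶠ) (enc (rem u X)) (remT n)
  rem-run X u X≤n = weaken (remT≥ X≤n)
    (filter-run (λ x → not (does (u ≟ x))) (call! remᶠ (1F ∷ 3F ∷ []))
    (λ x → not!! (does (u ≟ x)) (call! sameᶠ (4F ∷ 1F ∷ []) (same-run u x))) X)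

  confl-run : ∀ v u w → Run (encV v ∷ encV u ∷ encV w ∷ []) (code conflᶠ) (encodeBool (Confl v u w))
    (conflT n)
  confl-run v u w with a v u | adj-run v u | does (u ≟ w) | same-run u w | a u w | adj-run u w
  ... | false | r₁ | _ | _ | _ | _ = weaken (≤-trans (by-slack (3 * A + S + 18) (lemma A S)) (conflT≥ n))
    (match-nil! (call! adjᶠ (0F ∷ 1F ∷ []) r₁) nil!)
    where
    A = 3 + adjT n
    S = 3 + sameT n
    lemma : ∀ A S → suc (A + 1) + (3 * A + S + 18) ≡ 4 * A + S + 20
    lemma = solve-∀
  ... | true | r₁ | true | r₂ | _ | _ = weaken (≤-trans (by-slack (3 * A + 17) (lemma A S)) (conflT≥ n))
    (match-cons! (call! adjᶠ (0F ∷ 1F ∷ []) r₁) (match-cons! (call! sameᶠ (3F ∷ 4F ∷ []) r₂) nil!))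
    where
    A = 3 + adjT n
    S = 3 + sameT n
    lemma : ∀ A S → suc (A + suc (S + 1)) + (3 * A + 17) ≡ 4 * A + S + 20
    lemma = solve-∀
  ... | true | r₁ | false | r₂ | false | r₃ = weaken (≤-trans (by-slack (A + 17) (lemma A S)) (conflT≥ n))
    (match-cons! (call! adjᶠ (0F ∷ 1F ∷ []) r₁) (match-nil! (call! sameᶠ (3F ∷ 4F ∷ []) r₂)
      (match-nil! (call! adjᶠ (3F ∷ 4F ∷ []) r₃) (call! adjᶠ (2F ∷ 4F ∷ []) (adj-run v w)))))
    where
    A = 3 + adjT n
    S = 3 + sameT n
    lemma : ∀ A S → suc (A + suc (S + suc (A + A))) + (A + 17) ≡ 4 * A + S + 20
    lemma = solve-∀
  ... | true | r₁ | false | r₂ | true | r₃ = weaken (≤-trans (by-slack (A + 13) (lemma A S)) (conflT≥ n))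
    (match-cons! (call! adjᶠ (0F ∷ 1F ∷ []) r₁) (match-nil! (call! sameᶠ (3F ∷ 4F ∷ []) r₂)
      (match-cons! (call! adjᶠ (3F ∷ 4F ∷ []) r₃)
        (not!! (a v w) (call! adjᶠ (4F ∷ 6F ∷ []) (adj-run v w))))))
    where
    A = 3 + adjT n
    S = 3 + sameT n
    lemma : ∀ A S → suc (A + suc (S + suc (A + suc (A + 3)))) + (A + 13) ≡ 4 * A + S + 20
    lemma = solve-∀

  first-run : ∀ {again t C p q} {P : V → Set} {R} →
    (∀ {u X Us r′ r T} → Run (enc X ∷ p ∷ q ∷ []) (firstCode again t) r T →
      Run (r′ ∷ encV u ∷ enc X ∷ Us ∷ p ∷ q ∷ []) again r (4 + T)) →
    ∀ X → (∀ {u} → u ∈ X → ∀ us Us →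
      ∃[ r ] Run (encV u ∷ us ∷ Us ∷ p ∷ q ∷ []) t r C × Outcome (P u) R r) →
    ∃[ r ] Run (enc X ∷ p ∷ q ∷ []) (firstCode again t) r (firstT C (length X)) ×
      Outcome (∀ {u} → u ∈ X → P u) R r
  first-run rec [] each = _ , match-nil! (var! 0F) nil! , none λ ()
  first-run {C = C} rec (x ∷ X) each with each (here refl) (enc X) (enc (x ∷ X)) | first-run rec X (each ∘ there)
  ... | _ , r , some c | _ = _ , weaken (by-slack (6 + length X * (9 + C)) (lemma C (length X * (9 + C))))
    (match-cons! (var! 0F) (bind! r (match-cons! (var! 0F) (var! 2F)))) , some c
    where
    lemma : ∀ C y → suc (1 + suc (C + 3)) + (6 + y) ≡ 9 + C + y + 3
    lemma = solve-∀
  ... | _ , r , none p | _ , r′ , o = _ , weaken (≤-reflexive (lemma C (length X)))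
    (match-cons! (var! 0F) (bind! r (match-nil! (var! 0F) (rec r′)))) , extend o
    where
    lemma : ∀ C m → suc (1 + suc (C + suc (1 + (4 + (m * (9 + C) + 3))))) ≡ suc m * (9 + C) + 3
    lemma = solve-∀
    extend : ∀ {r} → Outcome _ _ r → Outcome _ _ r
    extend (none ps) = none λ { (here refl) → p ; (there u∈) → ps u∈ }
    extend (some c)  = some c

  -- The plan for a vertex

  Conflict : V → List V → List V → Val → Val → Set
  Conflict v U X h t = ∃₂ λ u w → u ∈ U × w ∈ X × Confl v u w ≡ true × h ≡ encV u × t ≡ encV w

  opaque
    confW-run : ∀ v u X → length X ≤ n → ∃[ r ]
      Run (enc X ∷ encV v ∷ encV u ∷ []) (code confWᶠ) r (confWT n) ×
      Outcome (∀ {w} → w ∈ X → Confl v u w ≡ false)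
        (λ h t → ∃[ w ] w ∈ X × Confl v u w ≡ true × h ≡ encV u × t ≡ encV w) r
    confW-run v u X X≤n with first-run (call! confWᶠ (2F ∷ 4F ∷ 5F ∷ [])) X each
      where
      each : ∀ {w} → w ∈ X → ∀ us Us → ∃[ r ]
        Run (encV w ∷ us ∷ Us ∷ encV v ∷ encV u ∷ [])
          (match (invoke conflᶠ (3F ∷ 4F ∷ 0F ∷ [])) nil (cons (var 6F) (var 2F))) r
          (suc (4 + conflT n + 3)) ×
        Outcome (Confl v u w ≡ false) (λ h t → ∃[ w ] w ∈ X × Confl v u w ≡ true × h ≡ encV u × t
          ≡ encV w) r
      each {w} w∈ _ _ with Confl v u w in eq | confl-run v u w
      ... | true  | r = _ , match-cons! (call! conflᶠ (3F ∷ 4F ∷ 0F ∷ []) r) (cons! (var! 6F) (var! 2F))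
                          , some (w , w∈ , eq , refl , refl)
      ... | false | r = _ , weaken (s≤s (+-monoʳ-≤ (4 + conflT n) (s≤s z≤n)))
                              (match-nil! (call! conflᶠ (3F ∷ 4F ∷ 0F ∷ []) r) nil!)
                          , none refl
    ... | _ , r , o = _ , weaken (confWT≥ X≤n) r , o

  opaque
    confU-run : ∀ v U X → length U ≤ n → length X ≤ n → ∃[ r ]
      Run (enc U ∷ encV v ∷ enc X ∷ []) (code confUᶠ) r (confUT n) ×
      Outcome (∀ {u} → u ∈ U → ∀ {w} → w ∈ X → Confl v u w ≡ false) (Conflict v U X) r
    confU-run v U X U≤n X≤n with first-run (call! confUᶠ (2F ∷ 4F ∷ 5F ∷ [])) U each
      where
      each : ∀ {u} → u ∈ U → ∀ us Us → ∃[ r ]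
        Run (encV u ∷ us ∷ Us ∷ encV v ∷ enc X ∷ []) (invoke confWᶠ (4F ∷ 3F ∷ 0F ∷ [])) r
          (4 + confWT n) ×
        Outcome (∀ {w} → w ∈ X → Confl v u w ≡ false) (Conflict v U X) r
      each {u} u∈ _ _ with confW-run v u X X≤n
      ... | _ , r , none free = _ , call! confWᶠ (4F ∷ 3F ∷ 0F ∷ []) r , none free
      ... | _ , r , some (w , w∈ , c , eqs) =
        _ , call! confWᶠ (4F ∷ 3F ∷ 0F ∷ []) r , some (u , w , u∈ , w∈ , c , eqs)
    ... | _ , r , o = _ , weaken (confUT≥ U≤n) r , o

  Fixer : V → List V → List V → Set
  Fixer v U X = ∃[ u ] u ∈ U × Free v (rem u X)

  opaque
    fix-run : ∀ v U X → length U ≤ n → length X ≤ n → ∃[ r ]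
      Run (enc U ∷ encV v ∷ enc X ∷ []) (code fixᶠ) r (fixT n) ×
      Outcome (∀ {u} → u ∈ U → ¬ Free v (rem u X)) (λ _ _ → Fixer v U X) r
    fix-run v U X U≤n X≤n with first-run (call! fixᶠ (2F ∷ 4F ∷ 5F ∷ [])) U each
      where
      each : ∀ {u} → u ∈ U → ∀ us Us → ∃[ r ]
        Run (encV u ∷ us ∷ Us ∷ encV v ∷ enc X ∷ [])
          (bind (invoke remᶠ (4F ∷ 0F ∷ [])) (not! (invoke confUᶠ (0F ∷ 4F ∷ 0F ∷ [])))) r
          (suc (3 + remT n + suc (4 + confUT n + 3))) ×
        Outcome (¬ Free v (rem u X)) (λ _ _ → Fixer v U X) r
      each {u} u∈ _ _ with confU-run v (rem u X) (rem u X) short′ short′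
        where
        short′ : length (rem u X) ≤ n
        short′ = ≤-trans (count≤length (λ x → not (does (u ≟ x))) X) X≤n
      ... | _ , r , none free =
        _ , bind! (call! remᶠ (4F ∷ 0F ∷ []) (rem-run X u X≤n))
              (match-nil! (call! confUᶠ (0F ∷ 4F ∷ 0F ∷ []) r) yes!!)
          , some (u , u∈ , λ x∈ → free x∈)
      ... | _ , r , some (x , w , x∈ , w∈ , c , _) =
        _ , bind! (call! remᶠ (4F ∷ 0F ∷ []) (rem-run X u X≤n))
              (weaken (s≤s (+-monoʳ-≤ (4 + confUT n) (s≤s z≤n)))
                (match-cons! (call! confUᶠ (0F ∷ 4F ∷ 0F ∷ []) r) nil!))
          , none λ free → true≢false (trans (sym c) (free x∈ w∈))
    ... | _ , r , o = _ , weaken (fixT≥ U≤n) r , o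

  -- The value steers `keepᶠ`: `nil` refuses, an empty head deletes the whole surplus at once, a
  -- pair as head is a conflict to split on. The time bound of a split rests on the last argument of
  -- `split`.
  data Plan (v : V) (X : List V) (D : Val) : Val → Set where
    small : count (a v) X < len D → Plan v X D nil
    leaf  : ∀ e → count (a v) X ≡ len e + len D →
      Free v X ⊎ (1 ≤ len e × Fixer v (nbrs v X) X) → Plan v X D (cons nil e)
    split : ∀ {u w} e → count (a v) X ≡ len e + len D → u ∈ X → w ∈ X → Confl v u w ≡ true →
      len e ≡ 0 ⊎ (1 ≤ len e × (∀ {z} → z ∈ nbrs v X → ¬ Free v (rem z X))) →
      Plan v X D (cons (cons (encV u) (encV w)) e)

  opaque
    plan-run : ∀ v X D → length X ≤ n → len D ≤ n →
      ∃[ r ] Run (encV v ∷ enc X ∷ D ∷ []) (code planᶠ) r (planT n) × Plan v X D r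
    plan-run v X D X≤n D≤n = decide (sub-run (enc (nbrs v X)) D)
      where
      N S C F : ℕ
      N = 3 + nbrsT n
      S = 3 + subT n
      C = 4 + confUT n
      F = 4 + fixT n
      N≤n : length (nbrs v X) ≤ n
      N≤n = ≤-trans (count≤length (a v) X) X≤n
      rN : Run (encV v ∷ enc X ∷ D ∷ []) (invoke nbrsᶠ (1F ∷ 0F ∷ [])) (enc (nbrs v X)) N
      rN = call! nbrsᶠ (1F ∷ 0F ∷ []) (nbrs-run X v X≤n)
      rS : ∀ {r} → Run (enc (nbrs v X) ∷ D ∷ []) (code subᶠ) r (subT (len D)) →
        Run (enc (nbrs v X) ∷ encV v ∷ enc X ∷ D ∷ []) (invoke subᶠ (0F ∷ 3F ∷ [])) r S
      rS r = call! subᶠ (0F ∷ 3F ∷ []) (weaken (subT-mono D≤n) r)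
      small-lemma : ∀ N S C F → suc (N + suc (S + 3)) + (C + F + 15) ≡ N + S + C + F + 20
      small-lemma = solve-∀
      free-lemma : ∀ N S C F →
        suc (N + suc (S + suc (1 + suc (C + 5)))) + (F + 10) ≡ N + S + C + F + 20
      free-lemma = solve-∀
      tight-lemma : ∀ N S C F →
        suc (N + suc (S + suc (1 + suc (C + suc (1 + 5))))) + (F + 8) ≡ N + S + C + F + 20
      tight-lemma = solve-∀
      fix-lemma : ∀ N S C F →
        suc (N + suc (S + suc (1 + suc (C + suc (1 + suc (1 + suc (F + 3))))))) + 7 ≡ N + S + C + F + 20
      fix-lemma = solve-∀
      decide : ∃[ r ] Run (enc (nbrs v X) ∷ D ∷ []) (code subᶠ) r (subT (len D)) × Sub
        (enc (nbrs v X)) D r →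
        ∃[ r ] Run (encV v ∷ enc X ∷ D ∷ []) (code planᶠ) r (planT n) × Plan v X D r
      decide (_ , rₛ , short lt) =
        _ , weaken (≤-trans (by-slack (C + F + 15) (small-lemma N S C F)) (planT≥ n))
              (bind! rN (bind! (rS rₛ) (match-nil! (var! 0F) nil!)))
          , small (subst (_< len D) (len-enc (nbrs v X)) lt)
      decide (_ , rₛ , rest e eq) with trans (sym (len-enc (nbrs v X))) eq | confU-run v X X X≤n X≤n
      decide (_ , rₛ , rest e eq) | N≡ | _ , rC , none free =
        _ , weaken (≤-trans (by-slack (F + 10) (free-lemma N S C F)) (planT≥ n))
              (bind! rN (bind! (rS rₛ) (match-cons! (var! 0F)
              (bind! (call! confUᶠ (5F ∷ 4F ∷ 5F ∷ []) rC)
              (match-nil! (var! 0F) (cons! nil! (var! 1F)))))))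
          , leaf e N≡ (inj₁ λ u∈ → free u∈)
      -- No neighbour of `v` can be spared here, so no fixer is sought.
      decide (_ , rₛ , rest nil eq) | N≡ | _ , rC , some (u , w , u∈ , w∈ , c , refl , refl) =
        _ , weaken (≤-trans (by-slack (F + 8) (tight-lemma N S C F)) (planT≥ n))
              (bind! rN (bind! (rS rₛ) (match-cons! (var! 0F)
              (bind! (call! confUᶠ (5F ∷ 4F ∷ 5F ∷ []) rC)
              (match-cons! (var! 0F) (match-nil! (var! 3F) (cons! (var! 2F) (var! 3F))))))))
          , split nil N≡ u∈ w∈ c (inj₁ refl)
      decide (_ , rₛ , rest e@(cons _ _) eq) | N≡ | _ , rC , some (u , w , u∈ , w∈ , c , refl , refl)
        with fix-run v (nbrs v X) X N≤n X≤n
      ... | _ , rF , none ¬fix =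
        _ , weaken (≤-trans (by-slack 7 (fix-lemma N S C F)) (planT≥ n))
              (bind! rN (bind! (rS rₛ) (match-cons! (var! 0F)
              (bind! (call! confUᶠ (5F ∷ 4F ∷ 5F ∷ []) rC)
              (match-cons! (var! 0F) (match-cons! (var! 3F)
              (match-nil! (call! fixᶠ (8F ∷ 9F ∷ 10F ∷ []) rF) (cons! (var! 4F) (var! 5F)))))))))
          , split e N≡ u∈ w∈ c (inj₂ (s≤s z≤n , ¬fix))
      ... | _ , rF , some fixer =
        _ , weaken (≤-trans (by-slack 7 (fix-lemma N S C F)) (planT≥ n))
              (bind! rN (bind! (rS rₛ) (match-cons! (var! 0F)
              (bind! (call! confUᶠ (5F ∷ 4F ∷ 5F ∷ []) rC)
              (match-cons! (var! 0F) (match-cons! (var! 3F)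
              (match-cons! (call! fixᶠ (8F ∷ 9F ∷ 10F ∷ []) rF) (cons! nil! (var! 7F)))))))))
          , leaf e N≡ (inj₂ (s≤s z≤n , fixer))

  Isolated : V → List V → Val → Set
  Isolated v X D = count (a v) X ≡ len D × Free v X

  ≢-surplus : ∀ {N e D} → N ≡ e + D → 1 ≤ e → N ≢ D
  ≢-surplus {e = suc e} {D} eq _ refl = m≢1+n+m D eq

  opaque
    -- Only a leaf with empty surplus means isolated: any other leaf has too many neighbours,
    -- `small` has too few, and a split exhibits a conflict.
    iso-run : ∀ {v X D r} → Plan v X D r → ∃[ b ] Run (r ∷ []) (code isoᶠ) (encodeBool b) 9 ×
      (b ≡ true → Isolated v X D) × (b ≡ false → ¬ Isolated v X D)
    iso-run (small lt) = false , weaken (s≤s (s≤s (s≤s z≤n))) (match-nil! (var! 0F) nil!)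
      , (λ ()) , λ _ (eq , _) → <⇒≢ lt eq
    iso-run (leaf nil eq (inj₁ free)) = true , match-cons! (var! 0F)
      (match-nil! (var! 0F) (match-nil! (var! 1F) yes!!))
      , (λ _ → eq , free) , λ ()
    iso-run (leaf e@(cons _ _) eq _) = false , weaken (m≤m+n 7 2)
        (match-cons! (var! 0F) (match-nil! (var! 0F) (match-cons! (var! 1F) nil!)))
      , (λ ()) , λ _ (eq′ , _) → ≢-surplus eq (s≤s z≤n) eq′
    iso-run (split e eq u∈ w∈ c _) = false , weaken (m≤m+n 5 4)
        (match-cons! (var! 0F) (match-cons! (var! 0F) nil!))
      , (λ ()) , λ _ (_ , free) → true≢false (trans (sym c) (free u∈ w∈))

  -- Costs of the two searches

  p : ℕ
  p = stepT n

  -- Up to the factor 2 ^ k, a vertex weighs two units in `solveT` and one in `keepT`. Deleting `v`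
  -- halves the factor and so costs one unit per vertex; keeping `v` costs the other. The extra `p`
  -- of `keepT` pays for the activation itself.
  keepT solveT : ℕ → ℕ → ℕ
  keepT x k  = p + 2 ^ k * ((1 + x) * p)
  solveT l k = 2 ^ k * ((1 + 2 * l) * p)

  record Solve (L : List V) (D k : Val) : Set where
    field
      answer   : Bool
      exec     : Run (enc L ∷ D ∷ k ∷ []) (code solveᶠ) (encodeBool answer) (solveT (length L) (len k))
      sound    : answer ≡ true → Cert (len D) L (len k)
      complete : ∀ {κ} → Clusters κ → Sol (len D) κ L (len k) → answer ≡ true

  -- The branch of v ∷ X in which v is kept.
  record Keep (v : V) (X : List V) (D k : Val) : Set where
    field
      answer   : Bool
      cost     : ℕ
      exec     : Run (encV v ∷ enc X ∷ D ∷ k ∷ []) (code keepᶠ) (encodeBool answer) cost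
      sound    : answer ≡ true → Cert (len D) (v ∷ X) (len k)
      complete : ∀ {κ} → Clusters κ → κ v ≡ false → Sol (len D) κ (v ∷ X) (len k) → answer ≡ true
      -- Three bounds for what a caller may know: too few neighbours mean one activation; if N[v] is
      -- not isolated, the halved bound holds; the last one also covers an N[v] that has become
      -- isolated, where keeping `v` spends no budget.
      cost-small    : count (a v) X < len D → cost ≤ p
      cost-conflict : ¬ Isolated v X D → cost ≤ keepT (length X) (len k)
      cost-any      : cost ≤ p + solveT (length X) (len k)

  -- This and the following left sides spell out the steps of single paths through `keepᶠ` and
  -- `solveᶠ`; a call with j arguments adds 1 + j.
  small-time : suc ((4 + planT n) + 3) ≤ p
  small-time = by-slack _ (lemma (planT n) (nonT n) (remT n) (subT n))
    where
    lemma : ∀ P N R S → suc ((4 + P) + 3) + (N + 2 * R + S + 52) ≡ P + N + 2 * R + S + 60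
    lemma = solve-∀

  over-time : suc ((4 + planT n) + suc (1 + suc (1 + suc ((3 + subT n) + 3)))) ≤ p
  over-time = by-slack _ (lemma (planT n) (nonT n) (remT n) (subT n))
    where
    lemma : ∀ P N R S → suc ((4 + P) + suc (1 + suc (1 + suc ((3 + S) + 3)))) + (N + 2 * R + 44)
      ≡ P + N + 2 * R + S + 60
    lemma = solve-∀

  leaf-time : ∀ f → suc ((4 + planT n) + suc (1 + suc (1 + suc ((3 + subT n) +
    suc (1 + suc ((3 + nonT n) + (4 + f))))))) ≤ p + f
  leaf-time = λ f → by-slack _ (lemma (planT n) (nonT n) (remT n) (subT n) f)
    where
    lemma : ∀ P N R S f → suc ((4 + P) + suc (1 + suc (1 + suc ((3 + S) +
      suc (1 + suc ((3 + N) + (4 + f))))))) + (2 * R + 37) ≡ P + N + 2 * R + S + 60 + f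
    lemma = solve-∀

  nobudget-time : suc ((4 + planT n) + suc (1 + suc (1 + suc (1 + 1)))) ≤ p
  nobudget-time = by-slack _ (lemma (planT n) (nonT n) (remT n) (subT n))
    where
    lemma : ∀ P N R S → suc ((4 + P) + suc (1 + suc (1 + suc (1 + 1)))) + (N + 2 * R + S + 48)
      ≡ P + N + 2 * R + S + 60
    lemma = solve-∀

  left-time : ∀ c c′ → suc ((4 + planT n) + suc (1 + suc (1 + suc (1 + suc ((3 + remT n) +
    suc ((5 + c) + 3)))))) ≤ p + (c + c′)
  left-time c c′ = by-slack _ (lemma (planT n) (nonT n) (remT n) (subT n) c c′)
    where
    lemma : ∀ P N R S c c′ → suc ((4 + P) + suc (1 + suc (1 + suc (1 + suc ((3 + R) +
      suc ((5 + c) + 3)))))) + (N + R + S + 36 + c′) ≡ P + N + 2 * R + S + 60 + (c + c′)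
    lemma = solve-∀

  right-time : ∀ c c′ → suc ((4 + planT n) + suc (1 + suc (1 + suc (1 + suc ((3 + remT n) +
    suc ((5 + c) + suc ((3 + remT n) + (5 + c′)))))))) ≤ p + (c + c′)
  right-time c c′ = by-slack _ (lemma (planT n) (nonT n) (remT n) (subT n) c c′)
    where
    lemma : ∀ P N R S c c′ → suc ((4 + P) + suc (1 + suc (1 + suc (1 + suc ((3 + R) +
      suc ((5 + c) + suc ((3 + R) + (5 + c′)))))))) + (N + S + 30) ≡ P + N + 2 * R + S + 60 + (c + c′)
    lemma = solve-∀

  isolated-time : ∀ f → suc (1 + suc ((4 + planT n) + suc ((2 + 9) + suc ((3 + nonT n) + (4 + f)))))
    ≤ p + f
  isolated-time f = by-slack _ (lemma (planT n) (nonT n) (remT n) (subT n) f)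
    where
    lemma : ∀ P N R S f → suc (1 + suc ((4 + P) + suc ((2 + 9) + suc ((3 + N) + (4 + f))))) +
      (2 * R + S + 33)
      ≡ P + N + 2 * R + S + 60 + f
    lemma = solve-∀

  kept-time : ∀ c → suc (1 + suc ((4 + planT n) + suc ((2 + 9) + suc ((5 + c) + 3)))) ≤ p + c
  kept-time c = by-slack _ (lemma (planT n) (nonT n) (remT n) (subT n) c)
    where
    lemma : ∀ P N R S c → suc (1 + suc ((4 + P) + suc ((2 + 9) + suc ((5 + c) + 3)))) +
      (N + 2 * R + S + 32)
      ≡ P + N + 2 * R + S + 60 + c
    lemma = solve-∀

  skip-time : ∀ c f → suc (1 + suc ((4 + planT n) + suc
    ((2 + 9) + suc ((5 + c) + suc (1 + (4 + f)))))) ≤ p + (c + f)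
  skip-time c f = by-slack _ (lemma (planT n) (nonT n) (remT n) (subT n) c f)
    where
    lemma : ∀ P N R S c f → suc (1 + suc ((4 + P) + suc
      ((2 + 9) + suc ((5 + c) + suc (1 + (4 + f)))))) + (N + 2 * R + S + 29)
      ≡ P + N + 2 * R + S + 60 + (c + f)
    lemma = solve-∀

  -- The recurrences for keepT and solveT

  isolated-growth : ∀ p q x → 1 ≤ q → p + q * ((1 + 2 * x) * p) ≤ q * ((1 + 2 * suc x) * p)
  isolated-growth p (suc r) x _ = by-slack (p + 2 * r * p) (lemma p r x)
    where
    lemma : ∀ p r x → p + suc r * ((1 + 2 * x) * p) + (p + 2 * r * p) ≡ suc r * ((1 + 2 * suc x) * p)
    lemma = solve-∀

  kept-growth : ∀ p q x → 1 ≤ q → p + (p + q * ((1 + x) * p)) ≤ q * ((1 + 2 * suc x) * p)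
  kept-growth p (suc r) x _ = by-slack (suc r * (x * p) + 2 * r * p) (lemma p r x)
    where
    lemma : ∀ p r x → p + (p + suc r * ((1 + x) * p)) + (suc r * (x * p) + 2 * r * p) ≡ suc r *
      ((1 + 2 * suc x) * p)
    lemma = solve-∀

  -- With q = 2 ^ k after the deletion of `v`, each branch needs 2 * q * x units and the bound
  -- offers 4 * q * x. The linear terms balance exactly; the share of `v` itself pays for the local
  -- work.
  skip-growth : ∀ p q x → 1 ≤ q →
    p + ((p + (2 * q) * ((1 + x) * p)) + q * ((1 + 2 * x) * p)) ≤ (2 * q) * ((1 + 2 * suc x) * p)
  skip-growth p (suc r) x _ = by-slack (p + 3 * r * p) (lemma p r x)
    where
    lemma : ∀ p r x → p + ((p + (2 * suc r) * ((1 + x) * p)) + suc r * ((1 + 2 * x) * p)) +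
      (p + 3 * r * p)
      ≡ (2 * suc r) * ((1 + 2 * suc x) * p)
    lemma = solve-∀

  -- One deletion halves the power of two, which pays for the doubled weight per vertex in `solveT`.
  leaf-growth : ∀ p q x → q * ((1 + 2 * x) * p) ≤ (2 * q) * ((1 + x) * p)
  leaf-growth p q x = by-slack (q * p) (lemma p q x)
    where
    lemma : ∀ p q x → q * ((1 + 2 * x) * p) + q * p ≡ (2 * q) * ((1 + x) * p)
    lemma = solve-∀

  split-growth : ∀ p q x → 1 ≤ q → 2 * p + q * ((2 * x) * p) ≤ (2 * q) * ((1 + x) * p)
  split-growth p (suc r) x _ = by-slack (2 * r * p) (lemma p r x)
    where
    lemma : ∀ p r x → 2 * p + suc r * ((2 * x) * p) + 2 * r * p ≡ (2 * suc r) * ((1 + x) * p)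
    lemma = solve-∀

  1≤2^ : ∀ k → 1 ≤ 2 ^ k
  1≤2^ k = m^n>0 2 k

  solveT-mono : ∀ {l l′ k k′} → l ≤ l′ → k ≤ k′ → solveT l k ≤ solveT l′ k′
  solveT-mono l≤ k≤ = *-mono-≤ (^-monoʳ-≤ 2 k≤) (*-monoˡ-≤ p (s≤s (*-monoʳ-≤ 2 l≤)))

  keepT≤solveT : ∀ x k → keepT x k ≤ p + solveT x k
  keepT≤solveT x k = +-monoʳ-≤ p (*-monoʳ-≤ (2 ^ k) (*-monoˡ-≤ p (s≤s (m≤m+n x _))))

  split-time : ∀ {c c′ x k} → c + c′ ≤ 2 * p + 2 ^ k * ((2 * x) * p) → p + (c + c′) ≤ keepT x (suc k)
  split-time {x = x} {k} le = +-monoʳ-≤ p (≤-trans le (split-growth p (2 ^ k) x (1≤2^ k)))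

  split-both : ∀ {c c′ x x₁ x₂ k} → c ≤ keepT x₁ k → c′ ≤ keepT x₂ k → x₁ < x → x₂ < x →
    c + c′ ≤ 2 * p + 2 ^ k * ((2 * x) * p)
  split-both {x = x} {x₁} {x₂} {k} le le′ lt lt′ = ≤-trans
    (+-mono-≤ (≤-trans le (up lt)) (≤-trans le′ (up lt′)))
    (≤-reflexive (lemma p (2 ^ k) x))
    where
    up : ∀ {x₁} → x₁ < x → keepT x₁ k ≤ p + 2 ^ k * (x * p)
    up lt = +-monoʳ-≤ p (*-monoʳ-≤ (2 ^ k) (*-monoˡ-≤ p lt))
    lemma : ∀ p q x → (p + q * (x * p)) + (p + q * (x * p)) ≡ 2 * p + q * ((2 * x) * p)
    lemma = solve-∀

  -- One child dies and the other may be unhalved: its weight 1 + 2 * x₂ is at most 2 * x, as much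
  -- as two halved children would need.
  split-tight : ∀ {c c′ x x₂ k} → c ≤ p → c′ ≤ p + solveT x₂ k → x₂ < x →
    c + c′ ≤ 2 * p + 2 ^ k * ((2 * x) * p)
  split-tight {x = x} {x₂} {k} le le′ lt = ≤-trans (+-mono-≤ le le′) (≤-trans
    (≤-reflexive (lemma p (2 ^ k * ((1 + 2 * x₂) * p))))
    (+-monoʳ-≤ (2 * p) (*-monoʳ-≤ (2 ^ k) (*-monoˡ-≤ p
      (≤-trans (s≤s (+-monoʳ-≤ x₂ (m≤n+m (x₂ + 0) 1))) (*-monoʳ-≤ 2 lt))))))
    where
    lemma : ∀ p y → p + (p + y) ≡ 2 * p + y
    lemma = solve-∀

  leaf-surplus : ∀ {x x′} e {k k′} → 1 ≤ len e → x′ ≤ x → k ≡ k′ + len e →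
    p + solveT x′ k′ ≤ keepT x k
  leaf-surplus {x} {x′} e {k} {k′} 1≤e x′≤x eq = +-monoʳ-≤ p (≤-trans (solveT-mono x′≤x (≤-refl {k′}))
    (≤-trans (leaf-growth p (2 ^ k′) x) (*-monoˡ-≤ ((1 + x) * p) (^-monoʳ-≤ 2
      (≤-trans (≤-reflexive (+-comm 1 k′)) (≤-trans (+-monoʳ-≤ k′ 1≤e) (≤-reflexive (sym eq))))))))

  conflict-adj : ∀ {v u w} → Confl v u w ≡ true → a v u ≡ true
  conflict-adj {v} {u} c with a v u
  ... | true = refl

  unique-rem : ∀ {v X} (u : V) → Unique (v ∷ X) → Unique (v ∷ rem u X)
  unique-rem {X = X} u (v∉X ∷ uq) = All.tabulate
    (λ x∈ → All.lookup v∉X (proj₁ (∈-rem⁻ u X x∈))) ∷ rem-unique u uq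

  -- Keeping the branching vertex

  refuse-small : ∀ {v X D k} → Unique (v ∷ X) → Run (encV v ∷ enc X ∷ D ∷ []) (code planᶠ) nil (planT n) →
    count (a v) X < len D → Keep v X D k
  refuse-small {v} {X} {D} {k} uq r lt = record
    { answer = false ; cost = p
    ; exec = weaken small-time (bind! (call! planᶠ (0F ∷ 1F ∷ 2F ∷ []) r) (match-nil! (var! 0F) nil!))
    ; sound = λ ()
    ; complete = λ cl kv s → let e , _ , eq , _ = sol-leaf uq cl kv s in
        contradiction (≤-trans (m≤n+m (len D) e) (≤-reflexive (sym eq))) (<⇒≱ lt)
    ; cost-small = λ _ → ≤-refl
    ; cost-conflict = λ _ → m≤m+n p _
    ; cost-any = m≤m+n p _
    }

  refuse-leaf : ∀ {v X D k e} → Unique (v ∷ X) →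
    Run (encV v ∷ enc X ∷ D ∷ []) (code planᶠ) (cons nil e) (planT n) → count (a v) X ≡ len e + len D →
    Run (k ∷ e ∷ []) (code subᶠ) nil (subT n) → len k < len e → Keep v X D k
  refuse-leaf {v} {X} {D} {k} {e} uq r eq rₛ lt = record
    { answer = false ; cost = p
    ; exec = weaken over-time (bind! (call! planᶠ (0F ∷ 1F ∷ 2F ∷ []) r)
        (match-cons! (var! 0F) (match-nil! (var! 0F)
        (bind! (call! subᶠ (6F ∷ 1F ∷ []) rₛ) (match-nil! (var! 0F) nil!)))))
    ; sound = λ ()
    ; complete = λ cl kv s → let e′ , k′ , eq′ , keq , _ = sol-leaf uq cl kv s
                                 e≡ = +-cancelʳ-≡ (len D) (len e) e′ (trans (sym eq) eq′) in
        contradiction (≤-trans (≤-reflexive e≡) (≤-trans (m≤m+n e′ k′) (≤-reflexive (sym keq)))) (<⇒≱ lt)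
    ; cost-small = λ _ → ≤-refl
    ; cost-conflict = λ _ → m≤m+n p _
    ; cost-any = m≤m+n p _
    }

  -- By `sol-leaf`, every solution that keeps `v` yields a solution of the same smaller instance,
  -- which gives completeness. Soundness spends the surplus on arbitrary neighbours, after the fixer
  -- if there is one.
  accept-leaf : ∀ {v X D k e k′} → Unique (v ∷ X) → length X ≤ n →
    Run (encV v ∷ enc X ∷ D ∷ []) (code planᶠ) (cons nil e) (planT n) →
    count (a v) X ≡ len e + len D → Free v X ⊎ (1 ≤ len e × Fixer v (nbrs v X) X) →
    Run (k ∷ e ∷ []) (code subᶠ) (cons k′ nil) (subT n) → len k ≡ len k′ + len e →
    Solve (non v X) D k′ → Keep v X D k
  accept-leaf {v} {X} {D} {k} {e} {k′} uq@(_ ∷ uqX) X≤n r eq why rₛ keq S = record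
    { answer = answer ; cost = p + solveT (length (non v X)) (len k′)
    ; exec = weaken (leaf-time _) (bind! (call! planᶠ (0F ∷ 1F ∷ 2F ∷ []) r)
        (match-cons! (var! 0F) (match-nil! (var! 0F)
        (bind! (call! subᶠ (6F ∷ 1F ∷ []) rₛ) (match-cons! (var! 0F)
        (bind! (call! nonᶠ (7F ∷ 6F ∷ []) (non-run X v X≤n)) (call! solveᶠ (0F ∷ 9F ∷ 1F ∷ []) exec)))))))
    ; sound = λ ok → subst (Cert (len D) (v ∷ X)) (trans (+-comm (len e) (len k′)) (sym keq))
        (certify e eq why (sound ok))
    ; complete = λ cl kv s → let e′ , k″ , eq′ , keq′ , s′ = sol-leaf uq cl kv s
                                 e≡ = +-cancelʳ-≡ (len D) (len e) e′ (trans (sym eq) eq′)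
                                 k≡ = +-cancelˡ-≡ (len e) k″ (len k′) (trans (cong (_+ k″) e≡)
                                   (trans (sym keq′) (trans keq (+-comm (len k′) (len e))))) in
        complete cl (subst (Sol (len D) _ (non v X)) k≡ s′)
    ; cost-small = λ lt → contradiction (≤-trans (m≤n+m (len D) (len e)) (≤-reflexive (sym eq))) (<⇒≱ lt)
    ; cost-conflict = conflict-cost e eq why keq
    ; cost-any = +-monoʳ-≤ p (solveT-mono non≤ (≤-trans (m≤m+n (len k′) (len e)) (≤-reflexive (sym keq))))
    }
    where
    open Solve S
    non≤ : length (non v X) ≤ length X
    non≤ = count≤length (not ∘ a v) X
    certify : ∀ e → count (a v) X ≡ len e + len D → Free v X ⊎ (1 ≤ len e × Fixer v (nbrs v X) X) →
      Cert (len D) (non v X) (len k′) → Cert (len D) (v ∷ X) (len e + len k′)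
    certify e eq (inj₁ free) c = cert-leaf (len e) uqX free eq c
    certify (cons _ e) eq (inj₂ (_ , u , u∈ , free)) c =
      let u∈X , vu = ∈-filterᵇ⁻ (a v) {xs = X} u∈ in cert-fix (len e) uqX u∈X vu free eq c
    conflict-cost : ∀ e → count (a v) X ≡ len e + len D → Free v X ⊎ (1 ≤ len e × Fixer v (nbrs v X) X) →
      len k ≡ len k′ + len e → ¬ Isolated v X D →
      p + solveT (length (non v X)) (len k′) ≤ keepT (length X) (len k)
    -- No conflict and no surplus would mean isolated; every other leaf deletes at least one
    -- neighbour, which halves the bound.
    conflict-cost nil eq (inj₁ free) keq ¬iso = contradiction (eq , λ {u} {w} → free {u} {w}) ¬iso
    conflict-cost e@(cons _ _) eq _ keq _ = leaf-surplus e (s≤s z≤n) non≤ keq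

  refuse-split : ∀ {v X D e u w} → Unique (v ∷ X) →
    Run (encV v ∷ enc X ∷ D ∷ []) (code planᶠ) (cons (cons (encV u) (encV w)) e) (planT n) →
    count (a v) X ≡ len e + len D → u ∈ X → w ∈ X → Confl v u w ≡ true → Keep v X D nil
  refuse-split {v} {X} {D} {e} {u} {w} uq@(v∉X ∷ _) r eq u∈ w∈ c = record
    { answer = false ; cost = p
    ; exec = weaken nobudget-time (bind! (call! planᶠ (0F ∷ 1F ∷ 2F ∷ []) r)
        (match-cons! (var! 0F) (match-cons! (var! 0F)
        (match-nil! (var! 8F) nil!))))
    ; sound = λ ()
    ; complete = λ cl kv s → ⊥-elim (fail kv s (conflict-deleted cl (All.lookup v∉X w∈) kv c))
    ; cost-small = λ _ → ≤-refl
    ; cost-conflict = λ _ → m≤m+n p _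
    ; cost-any = m≤m+n p _
    }
    where
    fail : ∀ {κ} → κ v ≡ false → Sol (len D) κ (v ∷ X) 0 → κ u ≡ true ⊎ κ w ≡ true → ⊥
    fail kv s (inj₁ ku) with () ← proj₁ (proj₂ (sol-del uq kv u∈ ku s))
    fail kv s (inj₂ kw) with () ← proj₁ (proj₂ (sol-del uq kv w∈ kw s))

  -- A kept `v` forces the deletion of `u` or `w`, so the two children are exhaustive. While `u` is
  -- a neighbour of `v`, `w` may or may not be one, and the time bound has to cover both cases.
  accept-split : ∀ {v X D h k e u w} → Unique (v ∷ X) → length X ≤ n →
    Run (encV v ∷ enc X ∷ D ∷ []) (code planᶠ) (cons (cons (encV u) (encV w)) e) (planT n) →
    count (a v) X ≡ len e + len D → u ∈ X → w ∈ X → Confl v u w ≡ true →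
    len e ≡ 0 ⊎ (1 ≤ len e × (∀ {z} → z ∈ nbrs v X → ¬ Free v (rem z X))) →
    Keep v (rem u X) D k → Keep v (rem w X) D k → Keep v X D (cons h k)
  accept-split {v} {X} {D} {h} {k} {e} {u} {w} uq@(v∉X ∷ uqX) X≤n r eq u∈ w∈ c surplus Kᵤ K_w = record
    { answer = U.answer ∨ W.answer ; cost = p + (U.cost + W.cost)
    ; exec = execute
    ; sound = certify
    ; complete = λ cl kv s → decide cl kv s (conflict-deleted cl (All.lookup v∉X w∈) kv c)
    ; cost-small = λ lt → contradiction (≤-trans (m≤n+m (len D) (len e)) (≤-reflexive (sym eq))) (<⇒≱ lt)
    ; cost-conflict = λ _ → time
    ; cost-any = ≤-trans time (keepT≤solveT (length X) (suc (len k)))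
    }
    where
    module U = Keep Kᵤ
    module W = Keep K_w
    vu : a v u ≡ true
    vu = conflict-adj c
    execute : Run (encV v ∷ enc X ∷ D ∷ cons h k ∷ []) (code keepᶠ) (encodeBool (U.answer ∨ W.answer))
      (p + (U.cost + W.cost))
    execute with U.answer | U.exec
    ... | true | ru = weaken (left-time U.cost W.cost)
      (bind! (call! planᶠ (0F ∷ 1F ∷ 2F ∷ []) r) (match-cons! (var! 0F) (match-cons! (var! 0F)
      (match-cons! (var! 8F) (bind! (call! remᶠ (8F ∷ 2F ∷ []) (rem-run X u X≤n))
      (match-cons! (call! keepᶠ (8F ∷ 0F ∷ 10F ∷ 2F ∷ []) ru) yes!!))))))
    ... | false | ru = weaken (right-time U.cost W.cost)
      (bind! (call! planᶠ (0F ∷ 1F ∷ 2F ∷ []) r) (match-cons! (var! 0F) (match-cons! (var! 0F)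
      (match-cons! (var! 8F) (bind! (call! remᶠ (8F ∷ 2F ∷ []) (rem-run X u X≤n))
      (match-nil! (call! keepᶠ (8F ∷ 0F ∷ 10F ∷ 2F ∷ []) ru)
      (bind! (call! remᶠ (9F ∷ 4F ∷ []) (rem-run X w X≤n))
        (call! keepᶠ (9F ∷ 0F ∷ 11F ∷ 3F ∷ []) W.exec))))))))
    certify : U.answer ∨ W.answer ≡ true → Cert (len D) (v ∷ X) (suc (len k))
    certify ok with U.answer | U.sound
    ... | true  | snd = del u u∈ (snd refl)
    ... | false | _   = del w w∈ (W.sound ok)
    decide : ∀ {κ} → Clusters κ → κ v ≡ false → Sol (len D) κ (v ∷ X) (suc (len k)) →
      κ u ≡ true ⊎ κ w ≡ true → U.answer ∨ W.answer ≡ true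
    decide cl kv s (inj₁ ku) with sol-del uq kv u∈ ku s
    ... | _ , refl , s′ = cong (_∨ W.answer) (U.complete cl kv s′)
    decide cl kv s (inj₂ kw) with sol-del uq kv w∈ kw s
    ... | _ , refl , s′ = trans (cong (U.answer ∨_) (W.complete cl kv s′)) (∨-zeroʳ U.answer)
    time : p + (U.cost + W.cost) ≤ keepT (length X) (suc (len k))
    time = split-time {U.cost} {W.cost} {length X} {len k} (children surplus)
      where
      children : len e ≡ 0 ⊎ (1 ≤ len e × (∀ {z} → z ∈ nbrs v X → ¬ Free v (rem z X))) →
        U.cost + W.cost ≤ 2 * p + 2 ^ len k * ((2 * length X) * p)
      -- Without surplus, deleting `u` leaves fewer than `D` neighbours, so that child is refused.
      children (inj₁ e≡0) = split-tight {x = length X} {length (rem w X)} {len k}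
        (U.cost-small (≤-reflexive (trans (sym (count-rem (a v) uqX u∈ vu))
          (trans eq (cong (_+ len D) e≡0)))))
        W.cost-any (length-rem w∈)
      children (inj₂ (1≤e , ¬fix)) = split-both {x = length X} {length (rem u X)} {length
        (rem w X)} {len k}
        (U.cost-conflict λ (_ , free) → ¬fix (∈-filterᵇ⁺ (a v) u∈ vu) λ {x} {y} → free {x} {y})
        (W.cost-conflict conflict-left)
        (length-rem u∈) (length-rem w∈)
        where
        -- If `w` is a neighbour of `v`, isolation would make it a fixer; otherwise its deletion
        -- leaves the positive surplus untouched.
        conflict-left : ¬ Isolated v (rem w X) D
        conflict-left (eq′ , free) with a v w in vw
        ... | true  = ¬fix (∈-filterᵇ⁺ (a v) w∈ vw) λ {x} {y} → free {x} {y}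
        ... | false = ≢-surplus (trans (cong length (filterᵇ-rem (a v) X vw)) eq) 1≤e eq′

  -- Solving an instance

  solve-empty : ∀ D k → Solve [] D k
  solve-empty D k = record
    { answer   = true
    -- The empty instance takes 5 steps, within the 60 included in `p`.
    ; exec     = weaken (≤-trans (≤-trans (m≤n+m 5 55)
        (m≤n+m 60 (planT n + nonT n + 2 * remT n + subT n)))
        (≤-trans (≤-reflexive (sym (trans (*-identityˡ (1 * p)) (*-identityˡ p))))
          (*-monoˡ-≤ (1 * p) (1≤2^ (len k)))))
        (match-nil! (var! 0F) yes!!)
    ; sound    = λ _ → done
    ; complete = λ _ _ → refl
    }

  solve-isolated : ∀ {v X D k r} → Unique (v ∷ X) → length X ≤ n →
    Run (encV v ∷ enc X ∷ D ∷ []) (code planᶠ) r (planT n) → Run (r ∷ []) (code isoᶠ)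
      (encodeBool true) 9 →
    Isolated v X D → Solve (non v X) D k → Solve (v ∷ X) D k
  solve-isolated {v} {X} {D} {k} uq X≤n r rᵢ (eq , free) S = record
    { answer   = answer
    ; exec     = weaken (≤-trans (isolated-time _)
        (≤-trans (+-monoʳ-≤ p (solveT-mono {k = len k} (count≤length (not ∘ a v) X) ≤-refl))
          (isolated-growth p (2 ^ len k) (length X) (1≤2^ (len k)))))
        (match-cons! (var! 0F) (bind! (call! planᶠ (0F ∷ 1F ∷ 3F ∷ []) r)
          (match-cons! (call! isoᶠ (0F ∷ []) rᵢ)
        (bind! (call! nonᶠ (4F ∷ 3F ∷ []) (non-run X v X≤n)) (call! solveᶠ (0F ∷ 7F ∷ 8F ∷ []) exec)))))
    ; sound    = λ ok → clq free eq (sound ok)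
    ; complete = λ cl s → complete cl (sol-isolated (λ {x} {y} → free {x} {y}) s)
    }
    where
    open Solve S

  solve-keep : ∀ {v X D k r} → Run (encV v ∷ enc X ∷ D ∷ []) (code planᶠ) r (planT n) →
    Run (r ∷ []) (code isoᶠ) (encodeBool false) 9 → ¬ Isolated v X D →
    (K : Keep v X D k) → Keep.answer K ≡ true → Solve (v ∷ X) D k
  solve-keep {v} {X} {D} {k} r rᵢ ¬iso K ok = record
    { answer   = true
    ; exec     = weaken (≤-trans (kept-time cost) (≤-trans (+-monoʳ-≤ p (cost-conflict ¬iso))
          (kept-growth p (2 ^ len k) (length X) (1≤2^ (len k)))))
        (match-cons! (var! 0F) (bind! (call! planᶠ (0F ∷ 1F ∷ 3F ∷ []) r)
          (match-nil! (call! isoᶠ (0F ∷ []) rᵢ)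
        (match-cons! (call! keepᶠ (1F ∷ 2F ∷ 4F ∷ 5F ∷ [])
          (subst (λ b → Run _ (code keepᶠ) (encodeBool b) cost) ok exec)) yes!!))))
    ; sound    = λ _ → sound ok
    ; complete = λ _ _ → refl
    }
    where
    open Keep K

  solve-refuse : ∀ {v X D r} → Run (encV v ∷ enc X ∷ D ∷ []) (code planᶠ) r (planT n) →
    Run (r ∷ []) (code isoᶠ) (encodeBool false) 9 → ¬ Isolated v X D →
    (K : Keep v X D nil) → Keep.answer K ≡ false → Solve (v ∷ X) D nil
  solve-refuse {v} {X} {D} r rᵢ ¬iso K bad = record
    { answer   = false
    ; exec     = weaken (≤-trans (kept-time cost) (≤-trans (+-monoʳ-≤ p (cost-conflict ¬iso))
          (kept-growth p 1 (length X) ≤-refl)))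
        (match-cons! (var! 0F) (bind! (call! planᶠ (0F ∷ 1F ∷ 3F ∷ []) r)
          (match-nil! (call! isoᶠ (0F ∷ []) rᵢ)
        (match-nil! (call! keepᶠ (1F ∷ 2F ∷ 4F ∷ 5F ∷ [])
          (subst (λ b → Run _ (code keepᶠ) (encodeBool b) cost) bad exec))
        (match-nil! (var! 5F) nil!)))))
    ; sound    = λ ()
    ; complete = λ {κ} cl s → ⊥-elim (fail κ cl s)
    }
    where
    open Keep K
    fail : ∀ κ → Clusters κ → Sol (len D) κ (v ∷ X) 0 → ⊥
    fail κ cl s with κ v in kv
    ... | true with () ← proj₁ (proj₂ (sol-skip kv s))
    ... | false = true≢false (trans (sym (complete cl kv s)) bad)

  solve-skip : ∀ {v X D h k r} → Run (encV v ∷ enc X ∷ D ∷ []) (code planᶠ) r (planT n) →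
    Run (r ∷ []) (code isoᶠ) (encodeBool false) 9 → ¬ Isolated v X D →
    (K : Keep v X D (cons h k)) → Keep.answer K ≡ false → Solve X D k → Solve (v ∷ X) D (cons h k)
  solve-skip {v} {X} {D} {h} {k} r rᵢ ¬iso K bad S = record
    { answer   = S.answer
    ; exec     = weaken (≤-trans (skip-time cost _)
        (≤-trans (+-monoʳ-≤ p (+-monoˡ-≤ _ (cost-conflict ¬iso)))
          (skip-growth p (2 ^ len k) (length X) (1≤2^ (len k)))))
        (match-cons! (var! 0F) (bind! (call! planᶠ (0F ∷ 1F ∷ 3F ∷ []) r)
          (match-nil! (call! isoᶠ (0F ∷ []) rᵢ)
        (match-nil! (call! keepᶠ (1F ∷ 2F ∷ 4F ∷ 5F ∷ [])
          (subst (λ b → Run _ (code keepᶠ) (encodeBool b) cost) bad exec))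
        (match-cons! (var! 5F) (call! solveᶠ (4F ∷ 6F ∷ 1F ∷ []) S.exec))))))
    ; sound    = λ ok → skip (S.sound ok)
    ; complete = λ {κ} cl s → decide κ cl s
    }
    where
    open Keep K
    module S = Solve S
    decide : ∀ κ → Clusters κ → Sol (len D) κ (v ∷ X) (suc (len k)) → S.answer ≡ true
    decide κ cl s with κ v in kv
    decide κ cl s | false = contradiction (trans (sym (complete cl kv s)) bad) true≢false
    decide κ cl s | true with sol-skip kv s
    ... | _ , refl , s′ = S.complete cl s′

  surplus≤ : ∀ v X {e} D → length X ≤ n → count (a v) X ≡ e + len D → e ≤ n
  surplus≤ v X {e} D X≤n eq = ≤-trans (m≤m+n e (len D))
    (≤-trans (≤-reflexive (sym eq)) (≤-trans (count≤length (a v) X) X≤n))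

  -- `m` is fuel: a split removes a vertex and lowers it, a leaf passes it on to `solve-run`, which
  -- takes one vertex off before coming back. The bound by `n` is separate, since all time bounds
  -- refer to the whole graph.
  keep-run : ∀ m v X D k → Unique (v ∷ X) → length X ≤ m → length X ≤ n → len D ≤ n → Keep v X D k
  solve-run : ∀ m L D k → Unique L → length L ≤ m → length L ≤ n → len D ≤ n → Solve L D k

  keep-run m v X D k uq X≤m X≤n D≤n with plan-run v X D X≤n D≤n
  ... | _ , r , small lt = refuse-small uq r lt
  keep-run m v X D k uq@(_ ∷ uqX) X≤m X≤n D≤n | _ , r , leaf e eq why with sub-run k e
  ... | _ , rₛ , short lt = refuse-leaf uq r eq (weaken (subT-mono (surplus≤ v X D X≤n eq)) rₛ) lt
  ... | _ , rₛ , rest k′ keq = accept-leaf uq X≤n r eq why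
    (weaken (subT-mono (surplus≤ v X D X≤n eq)) rₛ) keq
    (solve-run m (non v X) D k′ (filterᵇ-unique (not ∘ a v) uqX) (≤-trans non≤ X≤m)
      (≤-trans non≤ X≤n) D≤n)
    where
    non≤ : length (non v X) ≤ length X
    non≤ = count≤length (not ∘ a v) X
  keep-run m v X D nil uq X≤m X≤n D≤n | _ , r , split e eq u∈ w∈ c _ = refuse-split uq r eq u∈ w∈ c
  keep-run zero v [] D (cons _ k) uq X≤m X≤n D≤n | _ , r , split e eq () w∈ c surplus
  keep-run (suc m) v X D (cons _ k) uq X≤m X≤n D≤n | _ , r , split {u} {w} e eq u∈ w∈ c surplus =
    accept-split uq X≤n r eq u∈ w∈ c surplus (child u u∈) (child w w∈)
    where
    child : ∀ z → z ∈ X → Keep v (rem z X) D k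
    child z z∈ = keep-run m v (rem z X) D k (unique-rem z uq) (≤-pred (≤-trans (length-rem z∈) X≤m))
      (≤-trans (<⇒≤ (length-rem z∈)) X≤n) D≤n

  solve-run m [] D k uq L≤m L≤n D≤n = solve-empty D k
  solve-run (suc m) (v ∷ X) D k uq@(_ ∷ uqX) (s≤s X≤m) L≤n D≤n with plan-run v X D (<⇒≤ L≤n) D≤n
  ... | _ , r , pl with iso-run pl
  ... | true , rᵢ , iso , _ = solve-isolated uq X≤n r rᵢ (iso refl)
    (solve-run m (non v X) D k (filterᵇ-unique (not ∘ a v) uqX) (≤-trans non≤ X≤m) (≤-trans non≤ X≤n) D≤n)
    where
    X≤n : length X ≤ n
    X≤n = <⇒≤ L≤n
    non≤ : length (non v X) ≤ length X
    non≤ = count≤length (not ∘ a v) X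
  ... | false , rᵢ , _ , ¬iso = choose k (keep-run m v X D k uq X≤m (<⇒≤ L≤n) D≤n)
    where
    choose : ∀ k → Keep v X D k → Solve (v ∷ X) D k
    choose k K with Keep.answer K in ans
    choose k K | true = solve-keep r rᵢ (¬iso refl) K ans
    choose nil K | false = solve-refuse r rᵢ (¬iso refl) K ans
    choose (cons _ k) K | false = solve-skip r rᵢ (¬iso refl) K ans
      (solve-run m X D k uqX X≤m (<⇒≤ L≤n) D≤n)

  -- Trying all cluster sizes

  tryT : ℕ → ℕ → ℕ
  tryT F m = m * (11 + F) + (8 + F)

  record Try (D : Val) (L : List V) (k : Val) : Set where
    field
      answer   : Bool
      exec     : Run (D ∷ enc L ∷ k ∷ []) (code tryᶠ) (encodeBool answer)
        (tryT (solveT (length L) (len k)) (len D))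
      sound    : answer ≡ true → ∃[ d ] Cert d L (len k)
      complete : ∀ {d κ} → d ≤ len D → Clusters κ → Sol d κ L (len k) → answer ≡ true

  try-run : ∀ D L k → Unique L → length L ≤ n → len D ≤ n → Try D L k
  try-run D L k uq L≤n D≤n = attempt D D≤n (solve-run (length L) L D k uq ≤-refl L≤n D≤n)
    where
    F : ℕ
    F = solveT (length L) (len k)
    attempt : ∀ D → len D ≤ n → Solve L D k → Try D L k
    attempt D D≤n S with Solve.answer S in ans | Solve.exec S
    ... | true | r = record
      { answer = true
      ; exec = weaken (≤-trans (≤-reflexive (lemma F)) (m≤n+m (8 + F) (len D * (11 + F))))
          (match-cons! (call! solveᶠ (1F ∷ 0F ∷ 2F ∷ []) r) yes!!)
      ; sound = λ _ → _ , Solve.sound S ans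
      ; complete = λ _ _ _ → refl }
      where
      lemma : ∀ F → suc ((4 + F) + 3) ≡ 8 + F
      lemma = solve-∀
    attempt nil D≤n S | false | r = record
      { answer = false
      ; exec = weaken (≤-reflexive (lemma F))
          (match-nil! (call! solveᶠ (1F ∷ 0F ∷ 2F ∷ []) r) (match-nil! (var! 0F) nil!))
      ; sound = λ ()
      ; complete = λ { z≤n cl s → trans (sym ans) (Solve.complete S cl s) } }
      where
      lemma : ∀ F → suc ((4 + F) + 3) ≡ 8 + F
      lemma = solve-∀
    attempt (cons _ D) D<n S | false | r = record
      { answer = Rest.answer
      ; exec = weaken (≤-reflexive (lemma F (len D * (11 + F))))
          (match-nil! (call! solveᶠ (1F ∷ 0F ∷ 2F ∷ []) r) (match-cons! (var! 0F)
            (call! tryᶠ (1F ∷ 3F ∷ 4F ∷ []) Rest.exec)))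
      ; sound = Rest.sound
      ; complete = smaller }
      where
      lemma : ∀ F y → suc ((4 + F) + suc (1 + (4 + (y + (8 + F))))) ≡ 11 + F + y + (8 + F)
      lemma = solve-∀
      module Rest = Try (attempt D (<⇒≤ D<n) (solve-run (length L) L D k uq ≤-refl L≤n (<⇒≤ D<n)))
      smaller : ∀ {d κ} → d ≤ suc (len D) → Clusters κ → Sol d κ L (len k) → Rest.answer ≡ true
      smaller d≤ cl s with m≤n⇒m<n∨m≡n d≤
      ... | inj₁ d<  = Rest.complete (≤-pred d<) cl s
      ... | inj₂ refl = contradiction (trans (sym (Solve.complete S cl s)) ans) true≢false

-- Polynomial bounds

-- With base 2 + n instead of n, powers grow even at n = 0 and n = 1, which lets them absorb
-- constants and sums.
Bounded : (ℕ → ℕ) → Set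
Bounded f = ∃[ c ] (∀ n → f n ≤ (2 + n) ^ c)

bounded-const : ∀ c → Bounded (λ _ → c)
bounded-const c = c , λ n → ≤-trans (<⇒≤ (n<2^n c)) (^-monoˡ-≤ c (m≤m+n 2 n))
  where
  n<2^n : ∀ c → c < 2 ^ c
  n<2^n zero    = s≤s z≤n
  n<2^n (suc c) = ≤-trans (+-mono-≤ (m^n>0 2 c) (n<2^n c))
    (≤-reflexive (cong (2 ^ c +_) (sym (+-identityʳ (2 ^ c)))))

bounded-id : Bounded id
bounded-id = 1 , λ n → ≤-trans (m≤n+m n 2) (≤-reflexive (sym (*-identityʳ (2 + n))))

infixl 6 _⊕_
infixl 7 _⊗_

_⊕_ : ∀ {f g} → Bounded f → Bounded g → Bounded (λ n → f n + g n)
(a , f≤) ⊕ (b , g≤) = suc (a + b) , λ n → ≤-trans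
  (+-mono-≤ (≤-trans (f≤ n) (^-monoʳ-≤ (2 + n) (m≤m+n a b)))
    (≤-trans (g≤ n) (^-monoʳ-≤ (2 + n) (m≤n+m b a))))
  (≤-trans (≤-reflexive (cong ((2 + n) ^ (a + b) +_) (sym (+-identityʳ _))))
    (*-monoˡ-≤ ((2 + n) ^ (a + b)) (m≤m+n 2 n)))

_⊗_ : ∀ {f g} → Bounded f → Bounded g → Bounded (λ n → f n * g n)
(a , f≤) ⊗ (b , g≤) = a + b , λ n → ≤-trans (*-mono-≤ (f≤ n) (g≤ n))
  (≤-reflexive (sym (^-distribˡ-+-* (2 + n) a b)))

-- For n at least 2, 2 + n is at most n * n, which yields the exponent 2 * a. For smaller n the base
-- is at most 3, and the additive 3 ^ a suffices. One constant serves as exponent and as summand.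
bounded-poly : ∀ {f} → Bounded f → ∃[ c ] (∀ n → f n ≤ n ^ c + c)
bounded-poly (a , f≤) = 3 ^ a + 2 * a , λ n → ≤-trans (f≤ n) (power n)
  where
  power : ∀ n → (2 + n) ^ a ≤ n ^ (3 ^ a + 2 * a) + (3 ^ a + 2 * a)
  power 0 = ≤-trans (^-monoˡ-≤ a (n≤1+n 2)) (≤-trans (m≤m+n (3 ^ a) (2 * a))
    (m≤n+m _ (0 ^ (3 ^ a + 2 * a))))
  power 1 = ≤-trans (m≤m+n (3 ^ a) (2 * a)) (m≤n+m _ (1 ^ (3 ^ a + 2 * a)))
  power n@(suc (suc m)) = ≤-trans (^-monoˡ-≤ a (by-slack (3 * m + m * m) (square m)))
    (≤-trans (≤-reflexive (trans (cong (λ x → x ^ a) (sym (cong (n *_) (*-identityʳ n))))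
      (^-*-assoc n 2 a)))
    (≤-trans (^-monoʳ-≤ n (m≤n+m (2 * a) (3 ^ a))) (m≤m+n _ (3 ^ a + 2 * a))))
    where
    square : ∀ m → 2 + (2 + m) + (3 * m + m * m) ≡ (2 + m) * (2 + m)
    square = solve-∀

# : ∀ c → Bounded (λ _ → c)
# = bounded-const

bounded-filterT : ∀ {f g} → Bounded f → Bounded g → Bounded (λ n → filterT (f n) (g n))
bounded-filterT f g = g ⊗ (# 10 ⊕ f) ⊕ # 3

bounded-firstT : ∀ {f g} → Bounded f → Bounded g → Bounded (λ n → firstT (f n) (g n))
bounded-firstT f g = g ⊗ (# 9 ⊕ f) ⊕ # 3

opaque
  unfolding conflT

  bounded-stepT : Bounded stepT
  bounded-stepT = planB ⊕ nonB ⊕ # 2 ⊗ remB ⊕ subB ⊕ # 60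
    where
    X : Bounded id
    X = bounded-id
    adjB : Bounded adjT
    adjB = # 7 ⊕ (X ⊗ # 7 ⊕ # 5)
    sameB : Bounded sameT
    sameB = # 7 ⊕ (X ⊗ # 7 ⊕ # 7)
    subB : Bounded subT
    subB = X ⊗ # 7 ⊕ # 5
    nbrsB : Bounded nbrsT
    nbrsB = bounded-filterT (# 3 ⊕ adjB) X
    nonB : Bounded nonT
    nonB = bounded-filterT (# 1 ⊕ (# 3 ⊕ adjB ⊕ # 3)) X
    remB : Bounded remT
    remB = bounded-filterT (# 1 ⊕ (# 3 ⊕ sameB ⊕ # 3)) X
    conflB : Bounded conflT
    conflB = # 4 ⊗ (# 3 ⊕ adjB) ⊕ (# 3 ⊕ sameB) ⊕ # 20
    confWB : Bounded confWT
    confWB = bounded-firstT (# 1 ⊕ (# 4 ⊕ conflB ⊕ # 3)) X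
    confUB : Bounded confUT
    confUB = bounded-firstT (# 4 ⊕ confWB) X
    fixB : Bounded fixT
    fixB = bounded-firstT (# 1 ⊕ (# 3 ⊕ remB ⊕ (# 1 ⊕ (# 4 ⊕ confUB ⊕ # 3)))) X
    planB : Bounded planT
    planB = (# 3 ⊕ nbrsB) ⊕ (# 3 ⊕ subB) ⊕ (# 4 ⊕ confUB) ⊕ (# 4 ⊕ fixB) ⊕ # 20

-- The whole program

totalT : ℕ → ℕ
totalT n = 18 + mkT n + n * (11 + (1 + 2 * n) * stepT n) + (1 + 2 * n) * stepT n

bounded-totalT : Bounded totalT
bounded-totalT = # 18 ⊕ (X ⊗ # 13 ⊕ # 3) ⊕ X ⊗ (# 11 ⊕ (# 1 ⊕ # 2 ⊗ X) ⊗ bounded-stepT) ⊕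
  (# 1 ⊕ # 2 ⊗ X) ⊗ bounded-stepT
  where
  X : Bounded id
  X = bounded-id

opaque
  polynomial-totalT : ∃[ c ] (∀ n → totalT n ≤ n ^ c + c)
  polynomial-totalT = bounded-poly bounded-totalT

len-encodeℕ : ∀ k → len (encodeℕ k) ≡ k
len-encodeℕ zero    = refl
len-encodeℕ (suc k) = cong suc (len-encodeℕ k)

-- The factor 2 ^ k arises only in the calls of `solveᶠ`; being at least 1, it can be drawn in front
-- of the rest as well. The 18 is made of 10 steps of the main expression and the 8 of `tryT`.
total-growth : ∀ q f m n → 1 ≤ q →
  suc (1 + suc ((3 + m) + (4 + (n * (11 + q * f) + (8 + q * f))))) ≤ q * (18 + m + n * (11 + f) + f)
total-growth (suc r) f m n _ = by-slack (r * (18 + m + n * 11)) (lemma r f m n)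
  where
  lemma : ∀ r f m n → suc (1 + suc ((3 + m) + (4 + (n * (11 + suc r * f) + (8 + suc r * f))))) + r *
    (18 + m + n * 11)
    ≡ suc r * (18 + m + n * (11 + f) + f)
  lemma = solve-∀

decides : ∀ n (G : Graph (Fin n)) k → Decides program (encodeGraph G ∷ encodeℕ k ∷ []) (UCVD G k)
  (2 ^ k * totalT n)
decides n G k = answer , Run.steps main-run , Run.eval main-run , correct answer sound complete , Run.within main-run
  where
  open Combinatorics G
  open Runs G
  V≤n : length (allFin n) ≤ n
  V≤n = ≤-reflexive (length-tabulate id)
  lenV : len (enc (allFin n)) ≡ n
  lenV = trans (len-enc (allFin n)) (length-tabulate id)
  open Try (try-run (enc (allFin n)) (allFin n) (encodeℕ k) (allFin⁺ n) V≤n (≤-reflexive lenV))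
  time : suc (1 + suc ((3 + mkT n) + (4 + tryT (solveT (length (allFin n)) (len (encodeℕ k)))
    (len (enc (allFin n))))))
    ≤ 2 ^ k * totalT n
  time rewrite lenV | len-encodeℕ k | length-tabulate {n = n} (id {A = Fin n}) =
    total-growth (2 ^ k) ((1 + 2 * n) * stepT n) (mkT n) n (m^n>0 2 k)
  main-run : Run (encodeGraph G ∷ encodeℕ k ∷ []) (Program.main program) (encodeBool answer)
    (2 ^ k * totalT n)
  main-run = weaken time (bind! nil! (bind! (call! mkᶠ (0F ∷ 1F ∷ []) (mk-run id 0 (λ _ → refl)))
    (call! tryᶠ (0F ∷ 0F ∷ 3F ∷ []) exec)))
  correct : ∀ b → (b ≡ true → ∃[ d ] Cert d (allFin n) (len (encodeℕ k))) →
    (∀ {d κ} → d ≤ len (enc (allFin n)) → Clusters κ → Sol d κ (allFin n) (len (encodeℕ k)) → b ≡ true) →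
    Reflects (UCVD G k) b
  correct b snd cpl rewrite len-encodeℕ k | lenV = reflect b snd cpl
    where
    reflect : ∀ b → (b ≡ true → ∃[ d ] Cert d (allFin n) k) →
      (∀ {d κ} → d ≤ n → Clusters κ → Sol d κ (allFin n) k → b ≡ true) → Reflects (UCVD G k) b
    reflect true  snd cpl = ofʸ (UCVD-sound (proj₂ (snd refl)))
    reflect false snd cpl = ofⁿ λ u → let d , d≤n , κ , cl , s = UCVD-complete u in
      true≢false (sym (cpl d≤n cl s))

theorem18 : ∃[ P ] ∃[ c ] (∀ (n : ℕ) (G : Graph (Fin n)) (k : ℕ) .{{_ : NonZero k}} →
    Decides P (encodeGraph G ∷ encodeℕ k ∷ []) (UCVD G k) (2 ^ k * (n ^ c + c)))
theorem18 = program , proj₁ polynomial-totalT , λ n G k →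
  let b , t , returns , reflects , t≤ = decides n G k in
  b , t , returns , reflects , ≤-trans t≤ (*-monoʳ-≤ (2 ^ k) (proj₂ polynomial-totalT n))
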